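{- For all integers $\ell\geq 3$ and $k\geq 3$, \[ \mathrm{sat}_k(n,\text{Berge- }K_\ell)\sim\frac{\ell-2}{k-1}\,n \quad\text{as } n\to\infty, \] i.e. $\mathrm{sat}_k(n,\text{Berge- }K_\ell)=(1+o(1))\frac{\ell-2}{k-1}n$, where $k,\ell$ are fixed.
   Context: Let $F$ be a graph and $\mathcal{H}$ a hypergraph. $\mathcal{H}$ is a Berge-$F$ if $F$ and $\mathcal{H}$ can be embedded on a common vertex set so that there is a bijection $\phi:E(F)\to E(\mathcal{H})$ with $e\subseteq\phi(e)$ for every $e\in E(F)$. A hypergraph contains a Berge-$F$ if some subhypergraph (subset of its edges) is a Berge-$F$. A $k$-uniform hypergraph $\mathcal{H}$ on $n$ vertices is Berge-$F$-saturated if it contains no Berge-$F$, but for every $k$-subset $e$ of $V(\mathcal{H})$ with $e\notin E(\mathcal{H})$, the hypergraph $\mathcal{H}+e$ contains a Berge-$F$. The saturation number $\mathrm{sat}_k(n,\text{Berge- }F)$ is the minimum number of edges of a Berge-$F$-saturated $k$-uniform hypergraph on $n$ vertices. $K_\ell$ denotes the complete graph on $\ell$ vertices. -}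

module Defs where

open import Data.Nat using (ℕ; _≤_; _+_; _*_; _∸_)
open import Data.Fin using (Fin; _<_)
open import Data.Fin.Subset using (Subset; ∣_∣) renaming (_∈_ to _∈ₛ_)
open import Data.List using (List; length; lookup; _∷_)
open import Data.List.Membership.Propositional using (_∉_)
open import Data.List.Relation.Unary.All using (All)
open import Data.List.Relation.Unary.Unique.Propositional using (Unique)
open import Data.Product using (Σ; _×_; ∃)
open import Relation.Binary.PropositionalEquality using (_≡_)
open import Relation.Nullary using (¬_)
open import Function.Definitions using (Injective)

record Hypergraph (k n : ℕ) : Set where
  constructor hyp
  field
    edges   : List (Subset n)
    uniform : All (λ e → ∣ e ∣ ≡ k) edges
    simple  : Unique edges
open Hypergraph public

numEdges : ∀ {k n} → Hypergraph k n → ℕ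
numEdges H = length (edges H)

ContainsBergeK : ∀ {n} → ℕ → List (Subset n) → Set
ContainsBergeK {n} ℓ E =
  Σ (Fin ℓ → Fin n) λ f →
  Injective _≡_ _≡_ f ×
  Σ ((i j : Fin ℓ) → i < j → Fin (length E)) λ φ →
    (∀ i j i' j' (p : i < j) (p' : i' < j') →
       φ i j p ≡ φ i' j' p' → (i ≡ i') × (j ≡ j')) ×
    (∀ i j (p : i < j) →
       (f i ∈ₛ lookup E (φ i j p)) × (f j ∈ₛ lookup E (φ i j p)))

Saturated : ∀ {k n} → ℕ → Hypergraph k n → Set
Saturated {k} ℓ H =
  ¬ ContainsBergeK ℓ (edges H) ×
  (∀ e → ∣ e ∣ ≡ k → e ∉ edges H → ContainsBergeK ℓ (e ∷ edges H))

IsSatNumber : ℕ → ℕ → ℕ → ℕ → Set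
IsSatNumber k ℓ n m =
  (Σ (Hypergraph k n) λ H → Saturated ℓ H × numEdges H ≡ m) ×
  (∀ (H : Hypergraph k n) → Saturated ℓ H → m ≤ numEdges H)

{-# OPTIONS --safe #-}
module Submission where

-- Lower bound.  When a non-edge e completes a Berge clique, e plays the role of a pair uv of core
-- vertices, and the ℓ − 2 other core vertices are common neighbours of u and v, joined to u by
-- distinct old edges.  Let S be a maximal set of vertices of degree ≤ D without such pairs: all
-- k-subsets of S are edges, so S is small, and so is the union T of the closed neighbourhoods of S.
-- Each other vertex of degree ≤ D lies in ℓ − 2 edges meeting T, and an edge meeting T covers at
-- most k − 1 vertices outside T; vertices of degree > D are rare.
--
-- Upper bound.  Let C have ℓ − 2 vertices and cover the remaining vertices by blocks of size k − 1;
-- take all edges {c} ∪ D with c ∈ C and D a block.  The blocks are disjoint, except that two of them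
-- share a vertex v, and two more may overlap so that the sizes add up.  With x ≠ v in one of the
-- first two blocks, add an edge {c, c′} ∪ P with x ∈ P for every pair in C.  All vertices of a core
-- outside C lie in one component of blocks, which leaves one edge too few for a Berge clique.
-- Adding an edge through c, c′ ∈ C yields the core C ∪ {x, v} ({c, c′} ∪ P now serves the pair xc),
-- and adding one through vertices y, z of different components yields the core C ∪ {y, z}.  So a
-- greedy completion only has to consider sets inside a part of bounded size.

open import Defs
open import Data.Bool using (true; false; if_then_else_)
import Data.Bool.Properties as Boolₚ
open import Data.Empty using (⊥; ⊥-elim)
open import Data.Fin as Fin using (Fin; zero; suc; toℕ; _<_; punchIn; _↑ˡ_; _↑ʳ_; splitAt)
import Data.Fin.Properties as Finₚ
open import Data.Fin.Subset
  using (Subset; ∣_∣; ⁅_⁆; ⋃; _∪_; _∩_; _─_; Nonempty; inside; outside)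
  renaming (_∈_ to _∈ₛ_; _∉_ to _∉ₛ_; _⊆_ to _⊆ₛ_; ⊥ to ∅; ⊤ to full)
import Data.Fin.Subset.Properties as Subₚ
open import Data.List as List
  using (List; []; _∷_; length; lookup; map; filter; _++_; allFin; cartesianProductWith)
import Data.List.Properties as Listₚ
import Data.List.Membership.DecPropositional as DecMem
open import Data.List.Membership.Propositional using (_∈_; _∉_; find)
import Data.List.Membership.Propositional.Properties as Memₚ
open import Data.List.Relation.Binary.Subset.Propositional using (_⊆_)
open import Data.List.Relation.Unary.All as All using (All; []; _∷_)
import Data.List.Relation.Unary.All.Properties as Allₚ
open import Data.List.Relation.Unary.AllPairs as AllPairs using (AllPairs; []; _∷_; allPairs?)
open import Data.List.Relation.Unary.Any as Any using (here; there)
import Data.List.Relation.Unary.Any.Properties as Anyₚ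
open import Data.List.Relation.Unary.Unique.Propositional using (Unique)
import Data.List.Relation.Unary.Unique.Propositional.Properties as Uniqueₚ
open import Data.Maybe using (Maybe; just; nothing)
open import Data.Nat as ℕ using (ℕ; zero; suc; _+_; _*_; _∸_; _^_; _≤_; z≤n; s≤s)
open import Data.Nat.DivMod using (_/_; _%_; m≡m%n+[m/n]*n; m%n<n)
open import Data.Nat.ListAction using () renaming (sum to sumᴸ)
import Data.Nat.Properties as ℕₚ
open import Data.Nat.Tactic.RingSolver using (solve-∀)
open import Algebra.Properties.CommutativeMonoid.Sum ℕₚ.+-0-commutativeMonoid
  using (sum; ∑-distrib-+; sum-cong-≗)
open import Data.Product using (Σ; ∃; _×_; _,_; proj₁; proj₂; uncurry)
open import Data.Sum as Sum using (_⊎_; inj₁; inj₂)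
open import Data.Vec as Vec using (Vec; []; _∷_; here; there) renaming (_++_ to _⧺_)
import Data.Vec.Properties as Vecₚ
open import Function using (_∘_; id)
open import Function.Definitions using (Injective)
open import Relation.Binary.Definitions using (DecidableEquality; tri<; tri≈; tri>)
open import Relation.Binary.PropositionalEquality hiding ([_])
open import Relation.Nullary using (¬_; Dec; yes; no; contradiction; does)
open import Relation.Nullary.Decidable
  using (map′; _×-dec_; _⊎-dec_; _→-dec_; ¬?; toSum; decidable-stable)
open import Relation.Unary using (Pred; Decidable)

private variable
  X Y : Set
  ℓ m n k : ℕ

-- Lists without repetition, and Berge cliques free of edge positions.

Unique⇒length≤ : {xs ys : List X} → Unique xs → xs ⊆ ys → length xs ≤ length ys
Unique⇒length≤ {xs = []} _ _ = z≤n
Unique⇒length≤ {xs = x ∷ xs} (x∉ ∷ u) sub with Memₚ.∈-∃++ (sub (here refl))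
... | as , bs , refl = subst (suc (length xs) ≤_) len (s≤s (Unique⇒length≤ u sub′))
  where
  sub′ : xs ⊆ as ++ bs
  sub′ {y} y∈ with Memₚ.∈-++⁻ as (sub (there y∈))
  ... | inj₁ p = Memₚ.∈-++⁺ˡ p
  ... | inj₂ (here refl) = ⊥-elim (All.lookup x∉ y∈ refl)
  ... | inj₂ (there p) = Memₚ.∈-++⁺ʳ as p
  len : suc (length (as ++ bs)) ≡ length (as ++ x ∷ bs)
  len = trans (cong suc (Listₚ.length-++ as))
          (trans (sym (ℕₚ.+-suc (length as) (length bs))) (sym (Listₚ.length-++ as)))

-- Injectivity is asked on members of the list only: `uncurry edge` is known to be injective on
-- increasing pairs, and `realize` on valid codes.
map-Unique : {f : X → Y} {xs : List X} → (∀ {x y} → x ∈ xs → y ∈ xs → f x ≡ f y → x ≡ y) →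
             Unique xs → Unique (map f xs)
map-Unique {xs = []} inj [] = []
map-Unique {xs = x ∷ xs} inj (x∉ ∷ u) =
  Allₚ.map⁺ (All.tabulate λ y∈ eq → All.lookup x∉ y∈ (inj (here refl) (there y∈) eq)) ∷
  map-Unique (λ p q → inj (there p) (there q)) u

lookup-injective : {xs : List X} → Unique xs → ∀ {i j} → lookup xs i ≡ lookup xs j → i ≡ j
lookup-injective {xs = x ∷ xs} _ {zero} {zero} _ = refl
lookup-injective {xs = x ∷ xs} (x∉ ∷ _) {zero} {suc j} eq =
  ⊥-elim (All.lookup x∉ (Memₚ.∈-lookup j) eq)
lookup-injective {xs = x ∷ xs} (x∉ ∷ _) {suc i} {zero} eq =
  ⊥-elim (All.lookup x∉ (Memₚ.∈-lookup i) (sym eq))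
lookup-injective {xs = x ∷ xs} (_ ∷ u) {suc i} {suc j} eq = cong suc (lookup-injective u eq)

-- Edges are kept as sets instead of positions, so that cliques can move between edge lists. `edge`
-- is total, but its values matter on increasing pairs only.
record BergeClique (ℓ : ℕ) (E : List (Subset n)) : Set where
  field
    core      : Fin ℓ → Fin n
    core-inj  : Injective _≡_ _≡_ core
    edge      : Fin ℓ → Fin ℓ → Subset n
    edge∈     : ∀ {i j} → i < j → edge i j ∈ E
    left∈     : ∀ {i j} → i < j → core i ∈ₛ edge i j
    right∈    : ∀ {i j} → i < j → core j ∈ₛ edge i j
    edge-inj  : ∀ {i j i′ j′} → i < j → i′ < j′ → edge i j ≡ edge i′ j′ → i ≡ i′ × j ≡ j′

module _ {E : List (Subset n)} where

  fromBergeClique : BergeClique ℓ E → ContainsBergeK ℓ E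
  fromBergeClique K =
    core , core-inj , (λ i j p → Any.index (edge∈ p)) ,
    (λ i j i′ j′ p p′ eq → edge-inj p p′ (trans (lookup-edge p) (trans (cong (lookup E) eq) (sym (lookup-edge p′))))) ,
    λ i j p → subst (core i ∈ₛ_) (lookup-edge p) (left∈ p) , subst (core j ∈ₛ_) (lookup-edge p) (right∈ p)
    where
    open BergeClique K
    lookup-edge : ∀ {i j} (p : i < j) → edge i j ≡ lookup E (Any.index (edge∈ p))
    lookup-edge p = Anyₚ.lookup-index (edge∈ p)

  toBergeClique : Unique E → ContainsBergeK ℓ E → BergeClique ℓ E
  toBergeClique {ℓ = ℓ} u (f , f-inj , φ , φ-inj , φ∋) = record
    { core = f ; core-inj = f-inj ; edge = edge
    ; edge∈ = edge∈ ; left∈ = left∈ ; right∈ = right∈ ; edge-inj = edge-inj }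
    where
    edge : Fin ℓ → Fin ℓ → Subset _
    edge i j with i Finₚ.<? j
    ... | yes p = lookup E (φ i j p)
    ... | no _ = ∅
    edge-< : ∀ {i j} → i < j → ∃ λ p → edge i j ≡ lookup E (φ i j p)
    edge-< {i} {j} p with i Finₚ.<? j
    ... | yes q = q , refl
    ... | no ¬p = contradiction p ¬p
    edge∈ : ∀ {i j} → i < j → edge i j ∈ E
    edge∈ {i} {j} p with edge-< p
    ... | q , eq = subst (_∈ E) (sym eq) (Memₚ.∈-lookup (φ i j q))
    left∈ : ∀ {i j} → i < j → f i ∈ₛ edge i j
    left∈ {i} {j} p with edge-< p
    ... | q , eq = subst (f i ∈ₛ_) (sym eq) (proj₁ (φ∋ i j q))
    right∈ : ∀ {i j} → i < j → f j ∈ₛ edge i j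
    right∈ {i} {j} p with edge-< p
    ... | q , eq = subst (f j ∈ₛ_) (sym eq) (proj₂ (φ∋ i j q))
    edge-inj : ∀ {i j i′ j′} → i < j → i′ < j′ → edge i j ≡ edge i′ j′ → i ≡ i′ × j ≡ j′
    edge-inj p p′ eq with edge-< p | edge-< p′
    ... | q , e | q′ , e′ = φ-inj _ _ _ _ q q′ (lookup-injective u (trans (sym e) (trans eq e′)))

BergeClique-⊆ : {E E′ : List (Subset n)} → (∀ {e} → e ∈ E → e ∈ E′) → BergeClique ℓ E → BergeClique ℓ E′
BergeClique-⊆ sub K = record
  { core = core ; core-inj = core-inj ; edge = edge ; edge∈ = λ p → sub (edge∈ p)
  ; left∈ = left∈ ; right∈ = right∈ ; edge-inj = edge-inj }
  where open BergeClique K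

-- Positions in `E` say nothing about `E′`, so the clique is carried over by its edges.
ContainsBergeK-⊆ : {E E′ : List (Subset n)} → Unique E → (∀ {e} → e ∈ E → e ∈ E′) →
                   ContainsBergeK ℓ E → ContainsBergeK ℓ E′
ContainsBergeK-⊆ u sub c = fromBergeClique (BergeClique-⊆ sub (toBergeClique u c))

-- Existence of the saturation number

-- The search runs coordinate by coordinate. Entries enter only through their own `search`, so the
-- lemma can be iterated; it serves for tuples of vertices, tables of positions and whole edge
-- lists.
∃Vec? : {m : ℕ} → (∀ {P : X → Set} → (∀ a → Dec (P a)) → Dec (∃ P)) →
        {P : Vec X m → Set} → (∀ v → Dec (P v)) → Dec (∃ P)
∃Vec? {m = zero} search P? with P? []
... | yes p = yes ([] , p)
... | no ¬p = no λ { ([] , p) → ¬p p }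
∃Vec? {m = suc m} search P? with search (λ a → ∃Vec? search (λ v → P? (a ∷ v)))
... | yes (a , v , p) = yes (a ∷ v , p)
... | no ¬p = no λ { (a ∷ v , p) → ¬p (a , v , p) }

_≟ₛ_ : DecidableEquality (Subset n)
_≟ₛ_ = Vecₚ.≡-dec Boolₚ._≟_

_∈?_ : (e : Subset n) (E : List (Subset n)) → Dec (e ∈ E)
_∈?_ = DecMem._∈?_ _≟ₛ_

module _ (ℓ : ℕ) {n : ℕ} (E : List (Subset n)) where

  private
    Tuple : Set
    Tuple = Vec (Fin n) (2 + ℓ)

    Table : Set
    Table = Vec (Vec (Fin (length E)) (2 + ℓ)) (2 + ℓ)

    entry : Table → Fin (2 + ℓ) → Fin (2 + ℓ) → Fin (length E)
    entry t i j = Vec.lookup (Vec.lookup t i) j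

    IsBerge : Tuple → Table → Set
    IsBerge f t = (∀ i j → Vec.lookup f i ≡ Vec.lookup f j → i ≡ j) ×
      (∀ i j i′ j′ → i < j → i′ < j′ → entry t i j ≡ entry t i′ j′ → (i ≡ i′) × (j ≡ j′)) ×
      (∀ i j → i < j → Vec.lookup f i ∈ₛ lookup E (entry t i j) × Vec.lookup f j ∈ₛ lookup E (entry t i j))

    isBerge? : ∀ f t → Dec (IsBerge f t)
    isBerge? f t =
      (Finₚ.all? λ i → Finₚ.all? λ j → (Vec.lookup f i Finₚ.≟ Vec.lookup f j) →-dec (i Finₚ.≟ j)) ×-dec
      (Finₚ.all? λ i → Finₚ.all? λ j → Finₚ.all? λ i′ → Finₚ.all? λ j′ →
        (i Finₚ.<? j) →-dec ((i′ Finₚ.<? j′) →-dec ((entry t i j Finₚ.≟ entry t i′ j′) →-dec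
        ((i Finₚ.≟ i′) ×-dec (j Finₚ.≟ j′))))) ×-dec
      (Finₚ.all? λ i → Finₚ.all? λ j → (i Finₚ.<? j) →-dec
        ((Vec.lookup f i Subₚ.∈? lookup E (entry t i j)) ×-dec (Vec.lookup f j Subₚ.∈? lookup E (entry t i j))))

    encode : ContainsBergeK (2 + ℓ) E → ∃ λ f → ∃ λ t → IsBerge f t
    encode (f , f-inj , φ , φ-inj , φ∋) = Vec.tabulate f , table ,
      (λ i j eq → f-inj (trans (sym (look i)) (trans eq (look j)))) ,
      (λ i j i′ j′ p p′ eq → φ-inj i j i′ j′ p p′ (trans (sym (entry-< p)) (trans eq (entry-< p′)))) ,
      λ i j p → subst₂ _∈ₛ_ (sym (look i)) (cong (lookup E) (sym (entry-< p))) (proj₁ (φ∋ i j p)) ,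
                subst₂ _∈ₛ_ (sym (look j)) (cong (lookup E) (sym (entry-< p))) (proj₂ (φ∋ i j p))
      where
      look : ∀ i → Vec.lookup (Vec.tabulate f) i ≡ f i
      look = Vecₚ.lookup∘tabulate f
      total : Fin (2 + ℓ) → Fin (2 + ℓ) → Fin (length E)
      total i j with i Finₚ.<? j
      ... | yes p = φ i j p
      -- A table needs an entry for every pair. With at least two core vertices, the edge of the
      -- pair (0, 1) can fill the places that do not matter.
      ... | no _ = φ zero (suc zero) (s≤s z≤n)
      total-< : ∀ {i j} (p : i < j) → total i j ≡ φ i j p
      total-< {i} {j} p with i Finₚ.<? j
      ... | yes q = cong (φ i j) (ℕₚ.<-irrelevant q p)
      ... | no ¬p = contradiction p ¬p
      table : Table
      table = Vec.tabulate λ i → Vec.tabulate (total i)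
      entry-< : ∀ {i j} (p : i < j) → entry table i j ≡ φ i j p
      entry-< {i} {j} p = trans (cong (λ v → Vec.lookup v j) (Vecₚ.lookup∘tabulate (λ i → Vec.tabulate (total i)) i))
                            (trans (Vecₚ.lookup∘tabulate (total i) j) (total-< p))

    decode : (∃ λ f → ∃ λ t → IsBerge f t) → ContainsBergeK (2 + ℓ) E
    decode (f , t , f-inj , t-inj , t∋) = Vec.lookup f , f-inj _ _ , (λ i j _ → entry t i j) , t-inj , t∋

  abstract
    containsBergeK? : Dec (ContainsBergeK (2 + ℓ) E)
    containsBergeK? = map′ decode encode
      (∃Vec? Finₚ.any? λ f → ∃Vec? (∃Vec? Finₚ.any?) λ t → isBerge? f t)

module _ {P : ℕ → Set} (P? : ∀ i → Dec (P i)) where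

  private
    search : ∀ b → (∃ λ i → i ≤ b × P i × (∀ {j} → P j → i ≤ j)) ⊎ (∀ {i} → i ℕ.< b → ¬ P i)
    search zero = inj₂ λ ()
    search (suc b) with search b
    ... | inj₁ (i , i≤b , r) = inj₁ (i , ℕₚ.m≤n⇒m≤1+n i≤b , r)
    ... | inj₂ none with P? b
    ... | yes Pb = inj₁ (b , ℕₚ.n≤1+n b , Pb , λ Pj → ℕₚ.≮⇒≥ λ j<b → none j<b Pj)
    ... | no ¬Pb = inj₂ none′
      where
      none′ : ∀ {i} → i ℕ.< suc b → ¬ P i
      none′ (s≤s i≤b) Pi with ℕₚ.m≤n⇒m<n∨m≡n i≤b
      ... | inj₁ i<b = none i<b Pi
      ... | inj₂ refl = ¬Pb Pi

  leastWitness : ∀ {b} → P b → ∃ λ i → i ≤ b × P i × (∀ {j} → P j → i ≤ j)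
  leastWitness {b} Pb with search b
  ... | inj₁ r = r
  ... | inj₂ none = b , ℕₚ.≤-refl , Pb , λ Pj → ℕₚ.≮⇒≥ λ j<b → none j<b Pj

module _ (k ℓ n : ℕ) where

  private
    allSubset? : {P : Subset n → Set} → (∀ e → Dec (P e)) → Dec (∀ e → P e)
    allSubset? P? = map′ (λ ¬ex e → decidable-stable (P? e) λ ¬p → ¬ex (e , ¬p))
                         (λ all (e , ¬p) → ¬p (all e))
                         (¬? (Subₚ.anySubset? (¬? ∘ P?)))

    SaturatedEdges : List (Subset n) → Set
    SaturatedEdges E = ¬ ContainsBergeK (2 + ℓ) E ×
      (∀ e → ∣ e ∣ ≡ k → e ∉ E → ContainsBergeK (2 + ℓ) (e ∷ E))

    Attained : ℕ → Set
    Attained m = Σ (Hypergraph k n) λ H → Saturated (2 + ℓ) H × numEdges H ≡ m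

    saturatedEdges? : ∀ E → Dec (SaturatedEdges E)
    saturatedEdges? E = ¬? (containsBergeK? ℓ E) ×-dec
      (allSubset? λ e → (∣ e ∣ ℕₚ.≟ k) →-dec (¬? (e ∈? E) →-dec containsBergeK? ℓ (e ∷ E)))

    IsSaturatedHypergraph : List (Subset n) → Set
    IsSaturatedHypergraph E = All (λ e → ∣ e ∣ ≡ k) E × Unique E × SaturatedEdges E

    isSaturatedHypergraph? : ∀ E → Dec (IsSaturatedHypergraph E)
    isSaturatedHypergraph? E =
      All.all? (λ e → ∣ e ∣ ℕₚ.≟ k) E ×-dec (allPairs? (λ x y → ¬? (x ≟ₛ y)) E ×-dec saturatedEdges? E)

    -- For fixed `m` there are finitely many lists of `m` subsets, and saturation of each is
    -- decidable.
    attained? : ∀ m → Dec (Attained m)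
    attained? m = map′ to from (∃Vec? Subₚ.anySubset? λ v → isSaturatedHypergraph? (Vec.toList v))
      where
      to : ∃ (λ (v : Vec (Subset n) m) → IsSaturatedHypergraph (Vec.toList v)) → Attained m
      to (v , u , s , sat) = hyp (Vec.toList v) u s , sat , Vecₚ.length-toList v
      from : Attained m → ∃ (λ (v : Vec (Subset n) m) → IsSaturatedHypergraph (Vec.toList v))
      from (hyp E u s , sat , refl) = Vec.fromList E ,
        subst IsSaturatedHypergraph (sym (Vecₚ.toList∘fromList E)) (u , s , sat)

  -- One saturated hypergraph suffices: the attained edge counts form a decidable nonempty set of
  -- numbers, which has a least element.
  satNumber : (H : Hypergraph k n) → Saturated (2 + ℓ) H → ∃ λ m → IsSatNumber k (2 + ℓ) n m × m ≤ numEdges H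
  satNumber H sat with leastWitness attained? (H , sat , refl)
  ... | s , s≤ , attained , minimal = s , (attained , λ H′ sat′ → minimal (H′ , sat′ , refl)) , s≤

-- Counting in finite hypergraphs

∑-mono : {f g : Fin n → ℕ} → (∀ v → f v ≤ g v) → sum f ≤ sum g
∑-mono {zero} _ = z≤n
∑-mono {suc n} h = ℕₚ.+-mono-≤ (h zero) (∑-mono (h ∘ suc))

∑-const : ∀ c → sum {n} (λ _ → c) ≡ n * c
∑-const {zero} c = refl
∑-const {suc n} c = cong (c +_) (∑-const {n} c)

∑-*ˡ : ∀ c (f : Fin n → ℕ) → sum (λ v → c * f v) ≡ c * sum f
∑-*ˡ {zero} c f = sym (ℕₚ.*-zeroʳ c)
∑-*ˡ {suc n} c f = trans (cong (c * f zero +_) (∑-*ˡ c (f ∘ suc))) (sym (ℕₚ.*-distribˡ-+ c (f zero) (sum (f ∘ suc))))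

indicator : {P : Set} → Dec P → ℕ
indicator d = if does d then 1 else 0

*-indicator≤ : {P : Set} (d : Dec P) {c x : ℕ} → (P → c ≤ x) → c * indicator d ≤ x
*-indicator≤ (yes p) {c} {x} h = subst (_≤ x) (sym (ℕₚ.*-identityʳ c)) (h p)
*-indicator≤ (no _) {c} {x} h = subst (_≤ x) (sym (ℕₚ.*-zeroʳ c)) z≤n

≤*-indicator : {P : Set} (d : Dec P) {c : ℕ} → P → c ≤ c * indicator d
≤*-indicator (yes _) {c} _ = ℕₚ.≤-reflexive (sym (ℕₚ.*-identityʳ c))
≤*-indicator (no ¬p) p = contradiction p ¬p

∑-indicator : (e : Subset n) → sum (λ v → indicator (v Subₚ.∈? e)) ≡ ∣ e ∣
∑-indicator [] = refl
∑-indicator (inside ∷ e) = cong suc (∑-indicator e)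
∑-indicator (outside ∷ e) = ∑-indicator e

degree : List (Subset n) → Fin n → ℕ
degree E v = length (filter (v Subₚ.∈?_) E)

length-filter-∷ : {P : Pred X _} (P? : Decidable P) (x : X) (xs : List X) →
                  length (filter P? (x ∷ xs)) ≡ indicator (P? x) + length (filter P? xs)
length-filter-∷ P? x xs with does (P? x)
... | true = refl
... | false = refl

-- Double counting of incidences, one edge at a time.
∑-degree : (E : List (Subset n)) → sum (degree E) ≡ sumᴸ (map ∣_∣ E)
∑-degree {n} [] = trans (∑-const {n} 0) (ℕₚ.*-zeroʳ n)
∑-degree (e ∷ E) = trans (sum-cong-≗ (λ v → length-filter-∷ (v Subₚ.∈?_) e E))
  (trans (∑-distrib-+ (λ v → indicator (v Subₚ.∈? e)) (degree E)) (cong₂ _+_ (∑-indicator e) (∑-degree E)))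

sum-map≤ : (f : X → ℕ) (c : ℕ) {xs : List X} → (∀ {x} → x ∈ xs → f x ≤ c) → sumᴸ (map f xs) ≤ length xs * c
sum-map≤ f c {[]} h = z≤n
sum-map≤ f c {x ∷ xs} h = ℕₚ.+-mono-≤ (h (here refl)) (sum-map≤ f c (h ∘ there))

-- Applied with `g` = `outer`, which trims an edge meeting `T` to its vertices outside `T` and
-- empties all others: the edges at v that meet `T` are counted by the degree of v in the trimmed
-- list.
length-filter≤degree-map : {P : Pred (Subset n) _} (P? : Decidable P) (g : Subset n → Subset n) (v : Fin n) →
  (∀ {e} → P e → v ∈ₛ g e) → ∀ E → length (filter P? E) ≤ degree (map g E) v
length-filter≤degree-map P? g v h [] = z≤n
length-filter≤degree-map P? g v h (e ∷ E)
  rewrite length-filter-∷ P? e E | length-filter-∷ (v Subₚ.∈?_) (g e) (map g E) =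
  ℕₚ.+-mono-≤ step (length-filter≤degree-map P? g v h E)
  where
  step : indicator (P? e) ≤ indicator (v Subₚ.∈? g e)
  step with P? e | v Subₚ.∈? g e
  ... | no _ | _ = z≤n
  ... | yes _ | yes _ = ℕₚ.≤-refl
  ... | yes p | no v∉ = contradiction (h p) v∉

∣p∪q∣≤∣p∣+∣q∣ : (p q : Subset n) → ∣ p ∪ q ∣ ≤ ∣ p ∣ + ∣ q ∣
∣p∪q∣≤∣p∣+∣q∣ [] [] = z≤n
∣p∪q∣≤∣p∣+∣q∣ (inside ∷ p) (inside ∷ q) =
  s≤s (ℕₚ.≤-trans (∣p∪q∣≤∣p∣+∣q∣ p q) (ℕₚ.+-monoʳ-≤ ∣ p ∣ (ℕₚ.n≤1+n ∣ q ∣)))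
∣p∪q∣≤∣p∣+∣q∣ (inside ∷ p) (outside ∷ q) = s≤s (∣p∪q∣≤∣p∣+∣q∣ p q)
∣p∪q∣≤∣p∣+∣q∣ (outside ∷ p) (inside ∷ q) =
  subst (suc ∣ p ∪ q ∣ ≤_) (sym (ℕₚ.+-suc ∣ p ∣ ∣ q ∣)) (s≤s (∣p∪q∣≤∣p∣+∣q∣ p q))
∣p∪q∣≤∣p∣+∣q∣ (outside ∷ p) (outside ∷ q) = ∣p∪q∣≤∣p∣+∣q∣ p q

∣⋃∣≤ : (c : ℕ) (F : List (Subset n)) → (∀ {e} → e ∈ F → ∣ e ∣ ≤ c) → ∣ ⋃ F ∣ ≤ length F * c
∣⋃∣≤ {n} c [] h = ℕₚ.≤-reflexive (Subₚ.∣⊥∣≡0 n)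
∣⋃∣≤ c (e ∷ F) h = ℕₚ.≤-trans (∣p∪q∣≤∣p∣+∣q∣ e (⋃ F)) (ℕₚ.+-mono-≤ (h (here refl)) (∣⋃∣≤ c F (h ∘ there)))

x∈⋃ : {x : Fin n} {e : Subset n} {F : List (Subset n)} → e ∈ F → x ∈ₛ e → x ∈ₛ ⋃ F
x∈⋃ {F = _ ∷ F} (here refl) x∈ = Subₚ.x∈p∪q⁺ (inj₁ x∈)
x∈⋃ {F = f ∷ F} (there e∈) x∈ = Subₚ.x∈p∪q⁺ {p = f} (inj₂ (x∈⋃ e∈ x∈))

∣⁅x⁆∪p∣ : (x : Fin n) (p : Subset n) → x ∉ₛ p → ∣ ⁅ x ⁆ ∪ p ∣ ≡ suc ∣ p ∣
∣⁅x⁆∪p∣ zero (inside ∷ p) x∉ = contradiction here x∉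
∣⁅x⁆∪p∣ zero (outside ∷ p) x∉ = cong (suc ∘ ∣_∣) (Subₚ.∪-identityˡ p)
∣⁅x⁆∪p∣ (suc x) (inside ∷ p) x∉ = cong suc (∣⁅x⁆∪p∣ x p (x∉ ∘ there))
∣⁅x⁆∪p∣ (suc x) (outside ∷ p) x∉ = ∣⁅x⁆∪p∣ x p (x∉ ∘ there)

fromList : List (Fin n) → Subset n
fromList = ⋃ ∘ map ⁅_⁆

∈-fromList⁺ : {x : Fin n} {xs : List (Fin n)} → x ∈ xs → x ∈ₛ fromList xs
∈-fromList⁺ x∈ = x∈⋃ (Memₚ.∈-map⁺ ⁅_⁆ x∈) (Subₚ.x∈⁅x⁆ _)

∈-fromList⁻ : {x : Fin n} (xs : List (Fin n)) → x ∈ₛ fromList xs → x ∈ xs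
∈-fromList⁻ [] x∈ = contradiction x∈ Subₚ.∉⊥
∈-fromList⁻ (y ∷ xs) x∈ with Subₚ.x∈p∪q⁻ ⁅ y ⁆ (fromList xs) x∈
... | inj₁ p = here (Subₚ.x∈⁅y⁆⇒x≡y y p)
... | inj₂ p = there (∈-fromList⁻ xs p)

∣fromList∣ : {xs : List (Fin n)} → Unique xs → ∣ fromList xs ∣ ≡ length xs
∣fromList∣ {n} {xs = []} [] = Subₚ.∣⊥∣≡0 n
∣fromList∣ {xs = x ∷ xs} (x∉ ∷ u) = trans
  (∣⁅x⁆∪p∣ x (fromList xs) λ x∈ → All.lookup x∉ (∈-fromList⁻ xs x∈) refl) (cong suc (∣fromList∣ u))

-- Greedy choice: an element related to a chosen one is dominated by it; any other is chosen and
-- dominates itself by reflexivity.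
maximalIndependent : {_~_ : X → X → Set} → (∀ x y → Dec (x ~ y)) → (∀ x → x ~ x) → (xs : List X) →
  ∃ λ S → (∀ {s} → s ∈ S → s ∈ xs) × AllPairs (λ x y → ¬ (x ~ y)) S × (∀ {x} → x ∈ xs → ∃ λ s → s ∈ S × x ~ s)
maximalIndependent _~?_ rfl [] = [] , (λ ()) , [] , λ ()
maximalIndependent _~?_ rfl (x ∷ xs) with maximalIndependent _~?_ rfl xs
... | S , S⊆ , ind , dom with Any.any? (x ~?_) S
... | yes p = S , there ∘ S⊆ , ind , λ { (here refl) → find p ; (there q) → dom q }
... | no ¬p = x ∷ S , (λ { (here refl) → here refl ; (there q) → there (S⊆ q) }) , Allₚ.¬Any⇒All¬ S ¬p ∷ ind ,
  λ { (here refl) → x , here refl , rfl x ; (there q) → let s , s∈ , r = dom q in s , there s∈ , r }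

AllPairs⇒pairwise : {R : X → X → Set} {xs : List X} → (∀ {x y} → R x y → R y x) → AllPairs R xs →
  ∀ {x y} → x ∈ xs → y ∈ xs → x ≡ y ⊎ R x y
AllPairs⇒pairwise sy (_ ∷ _) (here refl) (here refl) = inj₁ refl
AllPairs⇒pairwise sy (r ∷ _) (here refl) (there q) = inj₂ (All.lookup r q)
AllPairs⇒pairwise sy (r ∷ _) (there p) (here refl) = inj₂ (sy (All.lookup r p))
AllPairs⇒pairwise sy (_ ∷ rs) (there p) (there q) = AllPairs⇒pairwise sy rs p q

Unique-++⁻ : (xs : List X) {ys : List X} → Unique (xs ++ ys) →
  Unique xs × Unique ys × (∀ {x} → x ∈ xs → x ∈ ys → ⊥)
Unique-++⁻ [] u = [] , u , λ ()
Unique-++⁻ (x ∷ xs) (x∉ ∷ u) = let ux , uy , disj = Unique-++⁻ xs u in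
  Allₚ.++⁻ˡ xs x∉ ∷ ux , uy , λ { (here refl) q → All.lookup (Allₚ.++⁻ʳ xs x∉) q refl ; (there p) q → disj p q }

splitAtLength : (j : ℕ) (xs : List X) → length xs ≤ j ⊎ ∃ λ ys → ∃ λ zs → xs ≡ ys ++ zs × length ys ≡ j
splitAtLength zero xs = inj₂ ([] , xs , refl , refl)
splitAtLength (suc j) [] = inj₁ z≤n
splitAtLength (suc j) (x ∷ xs) with splitAtLength j xs
... | inj₁ p = inj₁ (s≤s p)
... | inj₂ (ys , zs , refl , refl) = inj₂ (x ∷ ys , zs , refl , refl)

-- The lower bound

module SymmetricLinks {E : List (Subset n)} (K : BergeClique ℓ E) where
  open BergeClique K

  -- The edge of an unordered pair of core vertices; `edge` is meaningful for increasing pairs only.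
  link : Fin ℓ → Fin ℓ → Subset n
  link a b with a Finₚ.<? b
  ... | yes _ = edge a b
  ... | no _ = edge b a

  link-edge : ∀ {a b} → a ≢ b → ∃ λ x → ∃ λ y → x < y × link a b ≡ edge x y ×
              (a ≡ x × b ≡ y ⊎ a ≡ y × b ≡ x)
  link-edge {a} {b} a≢b with a Finₚ.<? b
  ... | yes p = a , b , p , refl , inj₁ (refl , refl)
  ... | no ¬p = b , a , ℕₚ.≤∧≢⇒< (ℕₚ.≮⇒≥ ¬p) (λ eq → a≢b (sym (Finₚ.toℕ-injective eq))) , refl , inj₂ (refl , refl)

  link-< : ∀ {a b} → a < b → link a b ≡ edge a b
  link-< {a} {b} p with a Finₚ.<? b
  ... | yes _ = refl
  ... | no ¬p = contradiction p ¬p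

  link-> : ∀ {a b} → a < b → link b a ≡ edge a b
  link-> {a} {b} p with b Finₚ.<? a
  ... | yes q = contradiction q (ℕₚ.<-asym p)
  ... | no _ = refl

  link∈ : ∀ {a b} → a ≢ b → link a b ∈ E
  link∈ a≢b with link-edge a≢b
  ... | x , y , p , eq , _ = subst (_∈ E) (sym eq) (edge∈ p)

  core∈link : ∀ {a b} → a ≢ b → core a ∈ₛ link a b × core b ∈ₛ link a b
  core∈link a≢b with link-edge a≢b
  ... | x , y , p , eq , inj₁ (refl , refl) rewrite eq = left∈ p , right∈ p
  ... | x , y , p , eq , inj₂ (refl , refl) rewrite eq = right∈ p , left∈ p

  link-inj : ∀ {a b a′ b′} → a ≢ b → a′ ≢ b′ → link a b ≡ link a′ b′ → a ≡ a′ × b ≡ b′ ⊎ a ≡ b′ × b ≡ a′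
  link-inj ab ab′ e with link-edge ab | link-edge ab′
  ... | x , y , p , eq , c | x′ , y′ , p′ , eq′ , c′ with edge-inj p p′ (trans (sym eq) (trans e eq′))
  link-inj ab ab′ e | _ , _ , _ , _ , inj₁ (refl , refl) | _ , _ , _ , _ , inj₁ (refl , refl) | refl , refl = inj₁ (refl , refl)
  link-inj ab ab′ e | _ , _ , _ , _ , inj₁ (refl , refl) | _ , _ , _ , _ , inj₂ (refl , refl) | refl , refl = inj₂ (refl , refl)
  link-inj ab ab′ e | _ , _ , _ , _ , inj₂ (refl , refl) | _ , _ , _ , _ , inj₁ (refl , refl) | refl , refl = inj₂ (refl , refl)
  link-inj ab ab′ e | _ , _ , _ , _ , inj₂ (refl , refl) | _ , _ , _ , _ , inj₂ (refl , refl) | refl , refl = inj₁ (refl , refl)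

module LowerBound (p′ M : ℕ) (H : Hypergraph (2 + p′) n) (sat : Saturated (2 + M) H) (D : ℕ) where

  E : List (Subset n)
  E = edges H

  -- The singleton keeps `s` in its closed neighbourhood even if no edge contains `s`.
  N : Fin n → Subset n
  N s = ⁅ s ⁆ ∪ ⋃ (filter (s Subₚ.∈?_) E)

  s∈N : ∀ s → s ∈ₛ N s
  s∈N s = Subₚ.x∈p∪q⁺ (inj₁ (Subₚ.x∈⁅x⁆ s))

  ∈N : ∀ {x s e} → e ∈ E → s ∈ₛ e → x ∈ₛ e → x ∈ₛ N s
  ∈N {s = s} e∈ s∈ x∈ = Subₚ.x∈p∪q⁺ {p = ⁅ s ⁆} (inj₂ (x∈⋃ (Memₚ.∈-filter⁺ (s Subₚ.∈?_) e∈ s∈) x∈))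

  Meets : Subset n → Fin n → Subset n → Set
  Meets T w e = w ∈ₛ e × Nonempty (e ∩ T)

  meets? : ∀ T w e → Dec (Meets T w e)
  meets? T w e = (w Subₚ.∈? e) ×-dec Subₚ.nonempty? (e ∩ T)

  -- The condition M ≤ … only retains of a core {w, s, c₁, …} with the pair ws missing that the edges
  -- from w to the cᵢ are distinct and meet the closed neighbourhood of s.
  _⇝_ : Fin n → Fin n → Set
  w ⇝ s = M ≤ length (filter (meets? (N s) w) E)

  -- Equality makes the relation reflexive, and independent lists free of repetitions. Asking for
  -- both directions makes it symmetric.
  _~_ : Fin n → Fin n → Set
  u ~ v = u ≡ v ⊎ (u ⇝ v × v ⇝ u)

  ~-sym : ∀ {u v} → u ~ v → v ~ u
  ~-sym (inj₁ eq) = inj₁ (sym eq)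
  ~-sym (inj₂ (a , b)) = inj₂ (b , a)

  _~?_ : ∀ u v → Dec (u ~ v)
  u ~? v = (u Finₚ.≟ v) ⊎-dec ((M ℕₚ.≤? _) ×-dec (M ℕₚ.≤? _))

  module _ {e : Subset n} (e∉ : e ∉ E) (K : BergeClique (2 + M) (e ∷ E)) where
    open BergeClique K
    open SymmetricLinks K

    -- As `e` already serves the pair ab and different pairs have different links, every other pair
    -- is served by an old edge.
    link∈E : ∀ {a b c d} → a ≢ b → link a b ≡ e → c ≢ d → ¬ (a ≡ c × b ≡ d) → ¬ (a ≡ d × b ≡ c) → link c d ∈ E
    link∈E ab eq cd n₁ n₂ with link∈ cd
    ... | there q = q
    ... | here eq′ with link-inj ab cd (trans eq (sym eq′))
    ... | inj₁ r = contradiction r n₁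
    ... | inj₂ r = contradiction r n₂

    -- The M + 1 links from `a` are distinct. The one to `b` is `e`; each of the other M is an old
    -- edge through a core vertex that an old edge joins to `b`, so it meets `N (core b)`.
    -- Cancelling `e` leaves M.
    replaced⇒⇝ : ∀ {a b} → a ≢ b → link a b ≡ e → core a ⇝ core b
    replaced⇒⇝ {a} {b} a≢b eq = ℕ.s≤s⁻¹ (subst (_≤ suc (length (filter P? E))) len (Unique⇒length≤ unique sub))
      where
      P? : ∀ e′ → Dec (Meets (N (core b)) (core a) e′)
      P? = meets? (N (core b)) (core a)
      star : List (Subset n)
      star = map (λ t → link a (punchIn a t)) (allFin (suc M))
      len : length star ≡ suc M
      len = trans (Listₚ.length-map _ (allFin (suc M))) (Listₚ.length-tabulate id)
      unique : Unique star
      unique = Uniqueₚ.map⁺ inj (Uniqueₚ.allFin⁺ (suc M))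
        where
        inj : ∀ {t t′} → link a (punchIn a t) ≡ link a (punchIn a t′) → t ≡ t′
        inj {t} {t′} q with link-inj (Finₚ.punchInᵢ≢i a t ∘ sym) (Finₚ.punchInᵢ≢i a t′ ∘ sym) q
        ... | inj₁ (_ , r) = Finₚ.punchIn-injective a t t′ r
        ... | inj₂ (r , _) = contradiction (sym r) (Finₚ.punchInᵢ≢i a t′)
      sub : ∀ {e′} → e′ ∈ star → e′ ∈ e ∷ filter P? E
      sub e′∈ with Memₚ.∈-map⁻ (λ t → link a (punchIn a t)) e′∈
      ... | t , _ , refl with punchIn a t Finₚ.≟ b
      ... | yes r = here (trans (cong (link a) r) eq)
      ... | no t≢b = there (Memₚ.∈-filter⁺ P? at∈ (proj₁ (core∈link a≢t) ,
              core (punchIn a t) , Subₚ.x∈p∩q⁺ (proj₂ (core∈link a≢t) ,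
              ∈N bt∈ (proj₁ (core∈link (t≢b ∘ sym))) (proj₂ (core∈link (t≢b ∘ sym))))))
        where
        a≢t : a ≢ punchIn a t
        a≢t = Finₚ.punchInᵢ≢i a t ∘ sym
        at∈ : link a (punchIn a t) ∈ E
        at∈ = link∈E a≢b eq a≢t (λ r → t≢b (sym (proj₂ r))) (λ r → a≢b (sym (proj₂ r)))
        bt∈ : link b (punchIn a t) ∈ E
        bt∈ = link∈E a≢b eq (t≢b ∘ sym) (λ r → a≢b (proj₁ r)) (λ r → a≢t (proj₁ r))

  -- If `e` served no pair of core vertices, the clique would consist of old edges, although `H`
  -- contains none.
  nonedge⇒~ : ∀ {e} → ∣ e ∣ ≡ 2 + p′ → e ∉ E → ∃ λ u → ∃ λ v → u ∈ₛ e × v ∈ₛ e × u ≢ v × u ~ v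
  nonedge⇒~ {e} size e∉ with toBergeClique (Allₚ.¬Any⇒All¬ E e∉ ∷ simple H) (proj₂ sat e size e∉)
  ... | K with Finₚ.any? (λ i → Finₚ.any? λ j → (i Finₚ.<? j) ×-dec (BergeClique.edge K i j ≟ₛ e))
  ... | no none = contradiction (fromBergeClique record
          { core = core ; core-inj = core-inj ; edge = edge ; edge∈ = old ; left∈ = left∈ ; right∈ = right∈
          ; edge-inj = edge-inj }) (proj₁ sat)
    where
    open BergeClique K
    old : ∀ {i j} → i < j → edge i j ∈ E
    old {i} {j} p with edge∈ p
    ... | here eq = contradiction (i , j , p , eq) none
    ... | there q = q
  ... | yes (i , j , p , eq) = core i , core j , subst (core i ∈ₛ_) eq (left∈ p) , subst (core j ∈ₛ_) eq (right∈ p) ,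
          (λ q → i≢j (core-inj q)) , inj₂
          (replaced⇒⇝ e∉ K i≢j (trans (link-< p) eq) , replaced⇒⇝ e∉ K (i≢j ∘ sym) (trans (link-> p) eq))
    where
    open BergeClique K
    open SymmetricLinks K
    i≢j : i ≢ j
    i≢j refl = ℕₚ.<-irrefl refl p

  low? : (v : Fin n) → Dec (degree E v ≤ D)
  low? v = degree E v ℕₚ.≤? D

  -- The first k - 1 elements of `S` form with each further element a k-set without related
  -- vertices, which must be an edge by `nonedge⇒~`. These edges are distinct and all contain the
  -- first element `s`, so there are at most D of them.
  independent⇒short : ∀ {S} → AllPairs (λ x y → ¬ (x ~ y)) S → (∀ {s} → s ∈ S → degree E s ≤ D) →
                      length S ≤ (2 + p′) + D
  independent⇒short {S} ind low with splitAtLength (suc p′) S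
  ... | inj₁ short = ℕₚ.≤-trans short (ℕₚ.≤-trans (ℕₚ.n≤1+n _) (ℕₚ.m≤m+n (2 + p′) D))
  ... | inj₂ (s ∷ ys , zs , refl , refl) = begin
        length (hs ++ zs) ≡⟨ Listₚ.length-++ hs ⟩
        length hs + length zs ≡⟨ cong (length hs +_) (sym (Listₚ.length-map extend zs)) ⟩
        length hs + length (map extend zs) ≤⟨ ℕₚ.+-monoʳ-≤ (length hs) (Unique⇒length≤ unique sub) ⟩
        length hs + degree E s ≤⟨ ℕₚ.+-mono-≤ (ℕₚ.n≤1+n (length hs)) (low (here refl)) ⟩
        (2 + p′) + D ∎
    where
    open ℕₚ.≤-Reasoning
    hs : List (Fin n)
    hs = s ∷ ys
    parts = Unique-++⁻ hs (AllPairs.map (λ ¬r eq → ¬r (inj₁ eq)) ind)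
    extend : Fin n → Subset n
    extend z = fromList (z ∷ hs)
    unique : Unique (map extend zs)
    unique = map-Unique inj (proj₁ (proj₂ parts))
      where
      inj : ∀ {x y} → x ∈ zs → y ∈ zs → extend x ≡ extend y → x ≡ y
      inj {x} {y} x∈ y∈ eq with ∈-fromList⁻ (y ∷ hs) (subst (x ∈ₛ_) eq (∈-fromList⁺ {xs = x ∷ hs} (here refl)))
      ... | here r = r
      ... | there r = ⊥-elim (proj₂ (proj₂ parts) r x∈)
    within : ∀ {x z} → z ∈ zs → x ∈ₛ extend z → x ∈ hs ++ zs
    within {z = z} z∈ x∈ with ∈-fromList⁻ (z ∷ hs) x∈
    ... | here refl = Memₚ.∈-++⁺ʳ hs z∈
    ... | there q = Memₚ.∈-++⁺ˡ q
    extend∈ : ∀ {z} → z ∈ zs → extend z ∈ E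
    extend∈ {z} z∈ with extend z ∈? E
    ... | yes q = q
    ... | no z∉ = ⊥-elim (absurd (nonedge⇒~
          (∣fromList∣ (Allₚ.¬Any⇒All¬ hs (λ q → proj₂ (proj₂ parts) q z∈) ∷ proj₁ parts)) z∉))
      where
      absurd : (∃ λ u → ∃ λ v → u ∈ₛ extend z × v ∈ₛ extend z × u ≢ v × u ~ v) → ⊥
      absurd (u , v , u∈ , v∈ , u≢v , u~v)
        with AllPairs⇒pairwise (λ ¬r r → ¬r (~-sym r)) ind (within z∈ u∈) (within z∈ v∈)
      ... | inj₁ eq = u≢v eq
      ... | inj₂ ¬r = ¬r u~v
    sub : ∀ {e} → e ∈ map extend zs → e ∈ filter (s Subₚ.∈?_) E
    sub e∈ with Memₚ.∈-map⁻ extend e∈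
    ... | z , z∈ , refl = Memₚ.∈-filter⁺ (s Subₚ.∈?_) (extend∈ z∈) (∈-fromList⁺ {xs = z ∷ hs} (there (here refl)))

  -- At most k + D independent vertices, each with a closed neighbourhood of at most 1 + Dk
  -- vertices.
  neighbourhoodBound : ℕ
  neighbourhoodBound = ((2 + p′) + D) * (1 + D * (2 + p′))

  -- `T` is the union of the closed neighbourhoods of a maximal independent set of vertices of
  -- degree at most D. Such a vertex w outside `T` is related to some s of that set and differs from
  -- it, so w ⇝ s; an edge meeting `N s` meets `T`.
  dominatingSet : ∃ λ T → ∣ T ∣ ≤ neighbourhoodBound ×
    (∀ w → degree E w ≤ D → w ∉ₛ T → M ≤ length (filter (meets? T w) E))
  dominatingSet with maximalIndependent _~?_ (λ _ → inj₁ refl) (filter low? (allFin n))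
  ... | S , S⊆ , ind , dom = T , T-small , many
    where
    T : Subset n
    T = ⋃ (map N S)
    low : ∀ {s} → s ∈ S → degree E s ≤ D
    low s∈ = proj₂ (Memₚ.∈-filter⁻ low? {xs = allFin n} (S⊆ s∈))
    ∣N∣≤ : ∀ {s} → s ∈ S → ∣ N s ∣ ≤ 1 + D * (2 + p′)
    ∣N∣≤ {s} s∈ = ℕₚ.≤-trans (∣p∪q∣≤∣p∣+∣q∣ ⁅ s ⁆ _) (ℕₚ.+-mono-≤ (ℕₚ.≤-reflexive (Subₚ.∣⁅x⁆∣≡1 s))
      (ℕₚ.≤-trans (∣⋃∣≤ (2 + p′) _ λ e∈ → ℕₚ.≤-reflexive
          (All.lookup (uniform H) (proj₁ (Memₚ.∈-filter⁻ (s Subₚ.∈?_) {xs = E} e∈))))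
        (ℕₚ.*-monoˡ-≤ (2 + p′) (low s∈))))
    T-small : ∣ T ∣ ≤ neighbourhoodBound
    T-small = ℕₚ.≤-trans (∣⋃∣≤ (1 + D * (2 + p′)) (map N S) bound)
      (ℕₚ.*-monoˡ-≤ (1 + D * (2 + p′)) (subst (_≤ (2 + p′) + D) (sym (Listₚ.length-map N S)) (independent⇒short ind low)))
      where
      bound : ∀ {e} → e ∈ map N S → ∣ e ∣ ≤ 1 + D * (2 + p′)
      bound e∈ with Memₚ.∈-map⁻ N e∈
      ... | s , s∈ , refl = ∣N∣≤ s∈
    N⊆T : ∀ {s x} → s ∈ S → x ∈ₛ N s → x ∈ₛ T
    N⊆T s∈ x∈ = x∈⋃ (Memₚ.∈-map⁺ N s∈) x∈
    many : ∀ w → degree E w ≤ D → w ∉ₛ T → M ≤ length (filter (meets? T w) E)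
    many w lw w∉ with dom (Memₚ.∈-filter⁺ low? (Memₚ.∈-allFin w) lw)
    ... | s , s∈ , inj₁ refl = contradiction (N⊆T s∈ (s∈N s)) w∉
    ... | s , s∈ , inj₂ (w⇝s , _) = ℕₚ.≤-trans w⇝s (Unique⇒length≤ (Uniqueₚ.filter⁺ (meets? (N s) w) (simple H)) sub)
      where
      sub : ∀ {e} → e ∈ filter (meets? (N s) w) E → e ∈ filter (meets? T w) E
      sub {e} e∈ with Memₚ.∈-filter⁻ (meets? (N s) w) {xs = E} e∈
      ... | e∈E , w∈e , x , x∈ = Memₚ.∈-filter⁺ (meets? T w) e∈E
            (w∈e , x , Subₚ.x∈p∩q⁺ (proj₁ (Subₚ.x∈p∩q⁻ e (N s) x∈) , N⊆T s∈ (proj₂ (Subₚ.x∈p∩q⁻ e (N s) x∈))))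

  -- `h` counts the vertices of degree above D, and the degree sum bounds it. For the second bound
  -- every vertex collects M units: from the edges meeting `T` if it is outside `T` and of degree at
  -- most D, from the terms for `T` and `h` otherwise.
  lowerBound : ∃ λ h → h * suc D ≤ numEdges H * (2 + p′) ×
    n * M ≤ (numEdges H * suc p′ + M * neighbourhoodBound) + M * h
  lowerBound with dominatingSet
  ... | T , T-small , many = h , highCount , main
    where
    open ℕₚ.≤-Reasoning
    high? : ∀ v → Dec (D ℕ.< degree E v)
    high? v = D ℕₚ.<? degree E v
    h : ℕ
    h = sum (λ v → indicator (high? v))
    highCount : h * suc D ≤ numEdges H * (2 + p′)
    highCount = begin
      h * suc D ≡⟨ ℕₚ.*-comm h (suc D) ⟩
      suc D * h ≡⟨ sym (∑-*ˡ (suc D) (λ v → indicator (high? v))) ⟩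
      sum (λ v → suc D * indicator (high? v)) ≤⟨ ∑-mono pointwise ⟩
      sum (degree E) ≡⟨ ∑-degree E ⟩
      sumᴸ (map ∣_∣ E) ≤⟨ sum-map≤ ∣_∣ (2 + p′) (λ e∈ → ℕₚ.≤-reflexive (All.lookup (uniform H) e∈)) ⟩
      numEdges H * (2 + p′) ∎
      where
      pointwise : ∀ v → suc D * indicator (high? v) ≤ degree E v
      pointwise v = *-indicator≤ (high? v) id
    outer : Subset n → Subset n
    outer e with Subₚ.nonempty? (e ∩ T)
    ... | yes _ = e ─ T
    ... | no _ = ∅
    ∈outer : ∀ {v e} → v ∉ₛ T → Meets T v e → v ∈ₛ outer e
    ∈outer {v} {e} v∉ (v∈ , ne) with Subₚ.nonempty? (e ∩ T)
    ... | yes _ = Subₚ.x∈p∧x∉q⇒x∈p─q v∈ v∉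
    ... | no ¬ne = contradiction ne ¬ne
    ∣outer∣≤ : ∀ {e} → e ∈ E → ∣ outer e ∣ ≤ suc p′
    ∣outer∣≤ {e} e∈ with Subₚ.nonempty? (e ∩ T)
    -- At least one of the k vertices lies in `T`; this yields the factor k - 1.
    ... | yes ne = ℕ.s≤s⁻¹ (subst (∣ e ─ T ∣ ℕ.<_) (All.lookup (uniform H) e∈) (Subₚ.p∩q≢∅⇒∣p─q∣<∣p∣ e T ne))
    ... | no _ = subst (_≤ suc p′) (sym (Subₚ.∣⊥∣≡0 n)) z≤n
    a b c : Fin n → ℕ
    a v = degree (map outer E) v
    b v = M * indicator (v Subₚ.∈? T)
    c v = M * indicator (high? v)
    pointwise : ∀ v → M ≤ (a v + b v) + c v
    pointwise v with toSum (v Subₚ.∈? T) | toSum (high? v)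
    ... | inj₁ v∈ | _ = ℕₚ.≤-trans (≤*-indicator (v Subₚ.∈? T) v∈) (ℕₚ.≤-trans (ℕₚ.m≤n+m _ (a v)) (ℕₚ.m≤m+n _ _))
    ... | inj₂ _ | inj₁ high = ℕₚ.≤-trans (≤*-indicator (high? v) high) (ℕₚ.m≤n+m _ _)
    ... | inj₂ v∉ | inj₂ ¬high = ℕₚ.≤-trans (many v (ℕₚ.≮⇒≥ ¬high) v∉)
          (ℕₚ.≤-trans (length-filter≤degree-map (meets? T v) outer v (∈outer v∉) E)
            (ℕₚ.≤-trans (ℕₚ.m≤m+n (a v) _) (ℕₚ.m≤m+n _ _)))
    sum-outer : sum a ≤ numEdges H * suc p′
    sum-outer = begin
      sum a ≡⟨ ∑-degree (map outer E) ⟩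
      sumᴸ (map ∣_∣ (map outer E)) ≡⟨ cong sumᴸ (sym (Listₚ.map-∘ E)) ⟩
      sumᴸ (map (∣_∣ ∘ outer) E) ≤⟨ sum-map≤ (∣_∣ ∘ outer) (suc p′) ∣outer∣≤ ⟩
      numEdges H * suc p′ ∎
    sum-T : sum b ≤ M * neighbourhoodBound
    sum-T = begin
      sum b ≡⟨ ∑-*ˡ M (λ v → indicator (v Subₚ.∈? T)) ⟩
      M * sum (λ v → indicator (v Subₚ.∈? T)) ≡⟨ cong (M *_) (∑-indicator T) ⟩
      M * ∣ T ∣ ≤⟨ ℕₚ.*-monoʳ-≤ M T-small ⟩
      M * neighbourhoodBound ∎
    main : n * M ≤ (numEdges H * suc p′ + M * neighbourhoodBound) + M * h
    main = begin
      n * M ≡⟨ sym (∑-const {n} M) ⟩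
      sum {n} (λ _ → M) ≤⟨ ∑-mono pointwise ⟩
      sum (λ v → (a v + b v) + c v) ≡⟨ ∑-distrib-+ (λ v → a v + b v) c ⟩
      sum (λ v → a v + b v) + sum c ≡⟨ cong₂ _+_ (∑-distrib-+ a b) (∑-*ˡ M (λ v → indicator (high? v))) ⟩
      (sum a + sum b) + M * h ≤⟨ ℕₚ.+-monoˡ-≤ (M * h) (ℕₚ.+-mono-≤ sum-outer sum-T) ⟩
      (numEdges H * suc p′ + M * neighbourhoodBound) + M * h ∎

-- The upper bound

module _ {p : Subset m} {q : Subset n} where

  ∈-++⁺ˡ : ∀ {i} → i ∈ₛ p → (i ↑ˡ n) ∈ₛ (p ⧺ q)
  ∈-++⁺ˡ {i} i∈ = Vecₚ.lookup⇒[]= (i ↑ˡ n) (p ⧺ q) (trans (Vecₚ.lookup-++ˡ p q i) (Vecₚ.[]=⇒lookup i∈))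

  ∈-++⁺ʳ : ∀ {j} → j ∈ₛ q → (m ↑ʳ j) ∈ₛ (p ⧺ q)
  ∈-++⁺ʳ {j} j∈ = Vecₚ.lookup⇒[]= (m ↑ʳ j) (p ⧺ q) (trans (Vecₚ.lookup-++ʳ p q j) (Vecₚ.[]=⇒lookup j∈))

  ∈-++⁻ˡ : ∀ {i} → (i ↑ˡ n) ∈ₛ (p ⧺ q) → i ∈ₛ p
  ∈-++⁻ˡ {i} i∈ = Vecₚ.lookup⇒[]= i p (trans (sym (Vecₚ.lookup-++ˡ p q i)) (Vecₚ.[]=⇒lookup i∈))

  ∈-++⁻ʳ : ∀ {j} → (m ↑ʳ j) ∈ₛ (p ⧺ q) → j ∈ₛ q
  ∈-++⁻ʳ {j} j∈ = Vecₚ.lookup⇒[]= j q (trans (sym (Vecₚ.lookup-++ʳ p q j)) (Vecₚ.[]=⇒lookup j∈))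

data Split (m : ℕ) {n : ℕ} : Fin (m + n) → Set where
  inˡ : ∀ i → Split m (i ↑ˡ n)
  inʳ : ∀ j → Split m (m ↑ʳ j)

split : ∀ m {n} (z : Fin (m + n)) → Split m z
split m z with splitAt m z in eq
... | inj₁ i = subst (Split m) (Finₚ.splitAt⁻¹-↑ˡ eq) (inˡ i)
... | inj₂ j = subst (Split m) (Finₚ.splitAt⁻¹-↑ʳ eq) (inʳ j)

∣p++q∣ : (p : Subset m) (q : Subset n) → ∣ p ⧺ q ∣ ≡ ∣ p ∣ + ∣ q ∣
∣p++q∣ [] q = refl
∣p++q∣ (inside ∷ p) q = cong suc (∣p++q∣ p q)
∣p++q∣ (outside ∷ p) q = ∣p++q∣ p q

⊆∧∣∣≡⇒≡ : {p q : Subset n} → p ⊆ₛ q → ∣ p ∣ ≡ ∣ q ∣ → p ≡ q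
⊆∧∣∣≡⇒≡ {p = p} {q} p⊆q eq = Subₚ.⊆-antisym p⊆q q⊆p
  where
  q⊆p : q ⊆ₛ p
  q⊆p {x} x∈ with x Subₚ.∈? p
  ... | yes r = r
  ... | no x∉ = contradiction eq (ℕₚ.<⇒≢ (Subₚ.p⊂q⇒∣p∣<∣q∣ (p⊆q , x , x∈ , x∉)))

length-cartesianProductWith : {X Y Z : Set} (f : X → Y → Z) (xs : List X) (ys : List Y) →
  length (cartesianProductWith f xs ys) ≡ length xs * length ys
length-cartesianProductWith f [] ys = refl
length-cartesianProductWith f (x ∷ xs) ys = trans (Listₚ.length-++ (map (f x) ys))
  (cong₂ _+_ (Listₚ.length-map (f x) ys) (length-cartesianProductWith f xs ys))

allSubsets : ∀ n → List (Subset n)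
allSubsets zero = [] ∷ []
allSubsets (suc n) = map (Vec._∷_ inside) (allSubsets n) ++ map (Vec._∷_ outside) (allSubsets n)

∈-allSubsets : (e : Subset n) → e ∈ allSubsets n
∈-allSubsets [] = here refl
∈-allSubsets (inside ∷ e) = Memₚ.∈-++⁺ˡ (Memₚ.∈-map⁺ (Vec._∷_ inside) (∈-allSubsets e))
∈-allSubsets (outside ∷ e) =
  Memₚ.∈-++⁺ʳ (map (Vec._∷_ inside) (allSubsets _)) (Memₚ.∈-map⁺ (Vec._∷_ outside) (∈-allSubsets e))

length-allSubsets : ∀ n → length (allSubsets n) ≡ 2 ^ n
length-allSubsets zero = refl
length-allSubsets (suc n) = trans (Listₚ.length-++ (map (Vec._∷_ inside) (allSubsets n))) (cong₂ _+_
  (trans (Listₚ.length-map (Vec._∷_ inside) (allSubsets n)) (length-allSubsets n))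
  (trans (Listₚ.length-map (Vec._∷_ outside) (allSubsets n)) (trans (length-allSubsets n) (sym (ℕₚ.+-identityʳ (2 ^ n))))))

pairs : ∀ m → List (Fin m × Fin m)
pairs zero = []
pairs (suc m) = map (λ t → zero , suc t) (allFin m) ++ map (λ (s , t) → suc s , suc t) (pairs m)

∈-pairs⁺ : {s t : Fin m} → s < t → (s , t) ∈ pairs m
∈-pairs⁺ {suc m} {zero} {suc t} _ = Memₚ.∈-++⁺ˡ (Memₚ.∈-map⁺ _ (Memₚ.∈-allFin t))
∈-pairs⁺ {suc m} {suc s} {suc t} (s≤s p) = Memₚ.∈-++⁺ʳ (map _ (allFin m)) (Memₚ.∈-map⁺ _ (∈-pairs⁺ p))

∈-pairs⁻ : {s t : Fin m} → (s , t) ∈ pairs m → s < t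
∈-pairs⁻ {suc m} st∈ with Memₚ.∈-++⁻ (map (λ t → zero , suc t) (allFin m)) st∈
... | inj₁ p with Memₚ.∈-map⁻ (λ t → zero , suc t) p
... | _ , _ , refl = s≤s z≤n
∈-pairs⁻ {suc m} st∈ | inj₂ p with Memₚ.∈-map⁻ (λ (s , t) → suc s , suc t) p
... | _ , q , refl = s≤s (∈-pairs⁻ q)

pairs-Unique : ∀ m → Unique (pairs m)
pairs-Unique zero = []
pairs-Unique (suc m) = Uniqueₚ.++⁺
  (Uniqueₚ.map⁺ (λ { refl → refl }) (Uniqueₚ.allFin⁺ m)) (Uniqueₚ.map⁺ (λ { refl → refl }) (pairs-Unique m)) disj
  where
  disj : ∀ {x} → ¬ (x ∈ map (λ t → zero , suc t) (allFin m) × x ∈ map (λ (s , t) → suc s , suc t) (pairs m))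
  disj (p , q) with Memₚ.∈-map⁻ (λ t → zero , suc t) p | Memₚ.∈-map⁻ (λ (s , t) → suc s , suc t) q
  ... | _ , _ , refl | _ , _ , ()

-- Pascal's rule. Applied twice it shows that adding two vertices adds 2m + 1 pairs, the count on
-- which `∣used∣` rests.
length-pairs-suc : ∀ m → length (pairs (suc m)) ≡ m + length (pairs m)
length-pairs-suc m = trans (Listₚ.length-++ (map (λ t → zero , suc t) (allFin m)))
  (cong₂ _+_ (trans (Listₚ.length-map (λ t → zero , suc t) (allFin m)) (Listₚ.length-tabulate id))
    (Listₚ.length-map (λ (s , t) → suc s , suc t) (pairs m)))

-- Greedy completion: a candidate is added unless it has the wrong size, is present or completes a
-- clique. In the last case it still does so after further additions, by `ContainsBergeK-⊆`.
complete : ∀ k ℓ (cs : List (Subset n)) (H : Hypergraph k n) → ¬ ContainsBergeK (2 + ℓ) (edges H) →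
  ∃ λ (H′ : Hypergraph k n) → ¬ ContainsBergeK (2 + ℓ) (edges H′) ×
    (∀ {e} → e ∈ edges H → e ∈ edges H′) ×
    (∀ {e} → e ∈ cs → ∣ e ∣ ≡ k → e ∉ edges H′ → ContainsBergeK (2 + ℓ) (e ∷ edges H′)) ×
    numEdges H′ ≤ length cs + numEdges H
complete k ℓ [] H free = H , free , id , (λ ()) , ℕₚ.≤-refl
complete k ℓ (c ∷ cs) H free with complete k ℓ cs H free
... | H₁ , free₁ , sub , sat , small with (∣ c ∣ ℕₚ.≟ k) ×-dec (¬? (c ∈? edges H₁) ×-dec ¬? (containsBergeK? ℓ (c ∷ edges H₁)))
... | yes (size , c∉ , freeᶜ) = hyp (c ∷ edges H₁) (size ∷ uniform H₁) (Allₚ.¬Any⇒All¬ _ c∉ ∷ simple H₁) ,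
      freeᶜ , there ∘ sub , sat′ , s≤s small
  where
  sat′ : ∀ {e} → e ∈ c ∷ cs → ∣ e ∣ ≡ k → e ∉ c ∷ edges H₁ → ContainsBergeK (2 + ℓ) (e ∷ c ∷ edges H₁)
  sat′ (here refl) _ e∉ = contradiction (here refl) e∉
  sat′ (there p) s e∉ = ContainsBergeK-⊆ (Allₚ.¬Any⇒All¬ _ (e∉ ∘ there) ∷ simple H₁)
    (λ { (here refl) → here refl ; (there q) → there (there q) }) (sat p s (e∉ ∘ there))
... | no ¬ok = H₁ , free₁ , sub , sat′ , ℕₚ.m≤n⇒m≤1+n small
  where
  sat′ : ∀ {e} → e ∈ c ∷ cs → ∣ e ∣ ≡ k → e ∉ edges H₁ → ContainsBergeK (2 + ℓ) (e ∷ edges H₁)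
  sat′ (here refl) s e∉ with containsBergeK? ℓ (c ∷ edges H₁)
  ... | yes r = r
  ... | no ¬r = contradiction (s , e∉ , ¬r) ¬ok
  sat′ (there p) = sat p

-- Blocks of size p = k − 1 on the w vertices outside C.  Components 0 and 1 consist of two blocks
-- each; components ≥ 2, called generic, are single blocks.  x, v and pad (P in the introduction) are
-- chosen in component 0.
record BlockSystem (p′ w : ℕ) : Set where
  field
    #blocks     : ℕ
    block       : Fin #blocks → Subset w
    ∣block∣     : ∀ b → ∣ block b ∣ ≡ suc p′
    block-inj   : ∀ {b b′} → block b ≡ block b′ → b ≡ b′
    component   : Fin w → ℕ
    bcomponent  : Fin #blocks → ℕ
    consistent  : ∀ {b y} → y ∈ₛ block b → component y ≡ bcomponent b
    cover       : ∀ y → ∃ λ b → y ∈ₛ block b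
    members     : ℕ → List (Fin #blocks)
    ∈members    : ∀ b → b ∈ members (bcomponent b)
    ∣members∣≤2 : ∀ a → length (members a) ≤ 2
    generic-inj : ∀ {b b′} → 2 ≤ bcomponent b → bcomponent b ≡ bcomponent b′ → b ≡ b′
    b₁ b₂       : Fin #blocks
    b₁≢b₂       : b₁ ≢ b₂
    x v         : Fin w
    x≢v         : x ≢ v
    x∈b₁        : x ∈ₛ block b₁
    v∈b₁        : v ∈ₛ block b₁
    v∈b₂        : v ∈ₛ block b₂
    pad         : Subset w
    ∣pad∣       : ∣ pad ∣ ≡ p′
    x∈pad       : x ∈ₛ pad
    component-pad : ∀ {y} → y ∈ₛ pad → component y ≡ 0
    candidates  : List (Subset w)
    ∈candidates : ∀ q → (∀ y → y ∈ₛ q → component y ℕ.< 2) → q ∈ candidates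

-- The base hypergraph and its saturated completion.

module Construction {p′ w : ℕ} (𝓑 : BlockSystem p′ w) (m : ℕ) where
  open BlockSystem 𝓑

  -- Names of the base edges. Counting and distinctness are argued on names and transferred to edges
  -- by `realize-inj`.
  data Code : Set where
    blk  : Fin #blocks → Fin m → Code
    link : Fin m → Fin m → Code

  realize : Code → Subset (m + w)
  realize (blk b t) = ⁅ t ⁆ ⧺ block b
  realize (link s t) = (⁅ s ⁆ ∪ ⁅ t ⁆) ⧺ pad

  links : List Code
  links = map (uncurry link) (pairs m)

  codes : List Code
  codes = cartesianProductWith blk (allFin #blocks) (allFin m) ++ links

  link∈codes : ∀ {s t : Fin m} → s < t → link s t ∈ codes
  link∈codes s<t = Memₚ.∈-++⁺ʳ (cartesianProductWith blk (allFin #blocks) (allFin m)) (Memₚ.∈-map⁺ (uncurry link) (∈-pairs⁺ s<t))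

  blk∈codes : ∀ b t → blk b t ∈ codes
  blk∈codes b t = Memₚ.∈-++⁺ˡ (Memₚ.∈-cartesianProductWith⁺ blk (Memₚ.∈-allFin b) (Memₚ.∈-allFin t))

  -- `link s t` and `link t s` realize the same edge, hence the restriction to increasing pairs.
  data Valid : Code → Set where
    blk  : ∀ b t → Valid (blk b t)
    link : ∀ {s t : Fin m} → s < t → Valid (link s t)

  valid : ∀ {c} → c ∈ codes → Valid c
  valid c∈ with Memₚ.∈-++⁻ (cartesianProductWith blk (allFin #blocks) (allFin m)) c∈
  ... | inj₁ p with Memₚ.∈-cartesianProductWith⁻ blk (allFin #blocks) (allFin m) p
  ... | b , t , _ , _ , refl = blk b t
  valid c∈ | inj₂ p with Memₚ.∈-map⁻ (uncurry link) p
  ... | (s , t) , q , refl = link (∈-pairs⁻ q)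

  realize-size : ∀ {c} → Valid c → ∣ realize c ∣ ≡ 2 + p′
  realize-size (blk b t) = trans (∣p++q∣ ⁅ t ⁆ (block b)) (cong₂ _+_ (Subₚ.∣⁅x⁆∣≡1 t) (∣block∣ b))
  realize-size (link {s} {t} s<t) = trans (∣p++q∣ (⁅ s ⁆ ∪ ⁅ t ⁆) pad) (cong₂ _+_
    (trans (∣⁅x⁆∪p∣ s ⁅ t ⁆ (Subₚ.x≢y⇒x∉⁅y⁆ (Finₚ.<⇒≢ s<t))) (cong suc (Subₚ.∣⁅x⁆∣≡1 t))) ∣pad∣)

  private
    s∈⁅s,t⁆ : ∀ (s t : Fin m) → s ∈ₛ ⁅ s ⁆ ∪ ⁅ t ⁆
    s∈⁅s,t⁆ s t = Subₚ.x∈p∪q⁺ (inj₁ (Subₚ.x∈⁅x⁆ s))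

    t∈⁅s,t⁆ : ∀ (s t : Fin m) → t ∈ₛ ⁅ s ⁆ ∪ ⁅ t ⁆
    t∈⁅s,t⁆ s t = Subₚ.x∈p∪q⁺ {p = ⁅ s ⁆} (inj₂ (Subₚ.x∈⁅x⁆ t))

    ∈⁅s,t⁆ : ∀ {r} (s t : Fin m) → r ∈ₛ ⁅ s ⁆ ∪ ⁅ t ⁆ → r ≡ s ⊎ r ≡ t
    ∈⁅s,t⁆ s t r∈ = Sum.map (Subₚ.x∈⁅y⁆⇒x≡y s) (Subₚ.x∈⁅y⁆⇒x≡y t) (Subₚ.x∈p∪q⁻ ⁅ s ⁆ ⁅ t ⁆ r∈)

    blk≢link : ∀ {b r} {s t : Fin m} → s < t → ¬ (realize (blk b r) ≡ realize (link s t))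
    blk≢link {b} {r} {s} {t} s<t eq with Vecₚ.++-injective ⁅ r ⁆ (⁅ s ⁆ ∪ ⁅ t ⁆) eq
    ... | eq′ , _ = Finₚ.<⇒≢ s<t (trans
      (Subₚ.x∈⁅y⁆⇒x≡y r (subst (s ∈ₛ_) (sym eq′) (s∈⁅s,t⁆ s t)))
      (sym (Subₚ.x∈⁅y⁆⇒x≡y r (subst (t ∈ₛ_) (sym eq′) (t∈⁅s,t⁆ s t)))))

  -- The centres of an edge tell the two kinds apart: one for a block edge, two for a link. Then the
  -- centres, and for a block edge also its outer part, determine the code.
  realize-inj : ∀ {c c′} → Valid c → Valid c′ → realize c ≡ realize c′ → c ≡ c′
  realize-inj (blk b t) (blk b′ t′) eq with Vecₚ.++-injective ⁅ t ⁆ ⁅ t′ ⁆ eq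
  ... | eq₁ , eq₂ = cong₂ blk (block-inj eq₂) (Subₚ.x∈⁅y⁆⇒x≡y t′ (subst (t ∈ₛ_) eq₁ (Subₚ.x∈⁅x⁆ t)))
  realize-inj (blk b t) (link p) eq = contradiction eq (blk≢link p)
  realize-inj (link p) (blk b t) eq = contradiction (sym eq) (blk≢link p)
  realize-inj (link {s} {t} p) (link {s′} {t′} p′) eq with Vecₚ.++-injective (⁅ s ⁆ ∪ ⁅ t ⁆) (⁅ s′ ⁆ ∪ ⁅ t′ ⁆) eq
  ... | eq₁ , _ = same p p′ (∈⁅s,t⁆ s′ t′ (subst (s ∈ₛ_) eq₁ (s∈⁅s,t⁆ s t))) (∈⁅s,t⁆ s′ t′ (subst (t ∈ₛ_) eq₁ (t∈⁅s,t⁆ s t)))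
    where
    same : ∀ {s t s′ t′ : Fin m} → s < t → s′ < t′ → s ≡ s′ ⊎ s ≡ t′ → t ≡ s′ ⊎ t ≡ t′ → link s t ≡ link s′ t′
    same _ _ (inj₁ refl) (inj₂ refl) = refl
    same p _ (inj₁ refl) (inj₁ refl) = contradiction refl (Finₚ.<⇒≢ p)
    same p _ (inj₂ refl) (inj₂ refl) = contradiction refl (Finₚ.<⇒≢ p)
    same p p′ (inj₂ refl) (inj₁ refl) = contradiction p (ℕₚ.<-asym p′)

  codes-Unique : Unique codes
  codes-Unique = Uniqueₚ.++⁺
    (Uniqueₚ.cartesianProductWith⁺ blk (λ { refl → refl , refl }) (Uniqueₚ.allFin⁺ #blocks) (Uniqueₚ.allFin⁺ m))
    (Uniqueₚ.map⁺ (λ { refl → refl }) (pairs-Unique m)) disj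
    where
    disj : ∀ {c} → ¬ (c ∈ cartesianProductWith blk (allFin #blocks) (allFin m) × c ∈ links)
    disj (p , q) with Memₚ.∈-cartesianProductWith⁻ blk (allFin #blocks) (allFin m) p | Memₚ.∈-map⁻ (uncurry link) q
    ... | _ , _ , _ , _ , refl | _ , _ , ()

  base : Hypergraph (2 + p′) (m + w)
  base = hyp (map realize codes) (Allₚ.map⁺ (All.tabulate λ c∈ → realize-size (valid c∈)))
    (map-Unique (λ c∈ c′∈ → realize-inj (valid c∈) (valid c′∈)) codes-Unique)

  numEdges-base : numEdges base ≡ #blocks * m + length (pairs m)
  numEdges-base = trans (Listₚ.length-map realize codes)
    (trans (Listₚ.length-++ (cartesianProductWith blk (allFin #blocks) (allFin m)))
      (cong₂ _+_
        (trans (length-cartesianProductWith blk (allFin #blocks) (allFin m))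
               (cong₂ _*_ (Listₚ.length-tabulate {n = #blocks} id) (Listₚ.length-tabulate {n = m} id)))
        (Listₚ.length-map (uncurry link) (pairs m))))

  cv : Fin m → Fin (m + w)
  cv t = t ↑ˡ w

  wv : Fin w → Fin (m + w)
  wv y = m ↑ʳ y

  sameComponent : ∀ {y z} c → wv y ∈ₛ realize c → wv z ∈ₛ realize c → component y ≡ component z
  sameComponent (blk b t) y∈ z∈ = trans (consistent (∈-++⁻ʳ y∈)) (sym (consistent (∈-++⁻ʳ z∈)))
  sameComponent (link s t) y∈ z∈ = trans (component-pad (∈-++⁻ʳ y∈)) (sym (component-pad (∈-++⁻ʳ z∈)))

  module Free (K : BergeClique (2 + m) (edges base)) where
    open BergeClique K

    position : ∀ {z} → Split m {w} z → Fin (suc m)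
    position (inˡ t) = suc t
    position (inʳ _) = zero

    -- Pigeonhole with m + 2 core vertices and m + 1 positions, one for each centre and one common
    -- to all outer vertices. Distinct core vertices cannot share a centre.
    twoOuter : ∃ λ i → ∃ λ j → i < j × (∃ λ y → core i ≡ wv y) × ∃ λ y → core j ≡ wv y
    twoOuter with Finₚ.pigeonhole (ℕₚ.n<1+n (suc m)) (λ i → position (split m (core i)))
    ... | i , j , i<j , eq = i , j , i<j , both (split m (core i)) (split m (core j)) refl refl eq
      where
      both : ∀ {a b} (va : Split m {w} a) (vb : Split m {w} b) → core i ≡ a → core j ≡ b → position va ≡ position vb →
             (∃ λ y → core i ≡ wv y) × ∃ λ y → core j ≡ wv y
      both (inˡ t) (inˡ .t) p q refl = contradiction (core-inj (trans p (sym q))) (Finₚ.<⇒≢ i<j)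
      both (inʳ y) (inʳ y′) p q _ = (y , p) , (y′ , q)

    linked : ∀ {i j} → i ≢ j → ∃ λ c → core i ∈ₛ realize c × core j ∈ₛ realize c
    linked {i} {j} i≢j with SymmetricLinks.link∈ K i≢j | SymmetricLinks.core∈link K i≢j
    ... | ∈base | i∈ , j∈ with Memₚ.∈-map⁻ realize ∈base
    ... | c , _ , eq = c , subst (core i ∈ₛ_) eq i∈ , subst (core j ∈ₛ_) eq j∈

    -- Two core vertices lie on a common base edge, and base edges do not join components.
    outerComponent : ∀ {i j y z} → core i ≡ wv y → core j ≡ wv z → component y ≡ component z
    outerComponent {i} {j} {y} {z} p q with i Finₚ.≟ j
    ... | yes refl = cong component (Finₚ.↑ʳ-injective m y z (trans (sym p) q))
    ... | no i≢j with linked i≢j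
    ... | c , i∈ , j∈ = sameComponent c (subst (_∈ₛ realize c) p i∈) (subst (_∈ₛ realize c) q j∈)

    -- An edge joining two core vertices is a link or comes from the component a of the core.
    used : ℕ → List Code
    used a = links ++ cartesianProductWith blk (members a) (allFin m)

    -- A component has at most two blocks, so at most C(m, 2) + 2m edges are available, one fewer
    -- than the C(m + 2, 2) pairs.
    ∣used∣ : ∀ a → length (used a) ℕ.< length (pairs (2 + m))
    ∣used∣ a = begin-strict
      length (used a) ≡⟨ Listₚ.length-++ links ⟩
      length links + length (cartesianProductWith blk (members a) (allFin m))
        ≡⟨ cong₂ _+_ (Listₚ.length-map (uncurry link) (pairs m))
             (trans (length-cartesianProductWith blk (members a) (allFin m))
                    (cong (length (members a) *_) (Listₚ.length-tabulate {n = m} id))) ⟩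
      length (pairs m) + length (members a) * m ≤⟨ ℕₚ.+-monoʳ-≤ (length (pairs m)) (ℕₚ.*-monoˡ-≤ m (∣members∣≤2 a)) ⟩
      length (pairs m) + 2 * m ≡⟨ ℕₚ.+-comm (length (pairs m)) (2 * m) ⟩
      (m + (m + 0)) + length (pairs m) ≡⟨ cong (λ z → (m + z) + length (pairs m)) (ℕₚ.+-identityʳ m) ⟩
      (m + m) + length (pairs m) ≡⟨ ℕₚ.+-assoc m m _ ⟩
      m + (m + length (pairs m)) <⟨ ℕₚ.n<1+n _ ⟩
      suc m + (m + length (pairs m)) ≡⟨ cong (suc m +_) (sym (length-pairs-suc m)) ⟩
      suc m + length (pairs (suc m)) ≡⟨ sym (length-pairs-suc (suc m)) ⟩
      length (pairs (2 + m)) ∎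
      where open ℕₚ.≤-Reasoning

    absurd : ⊥
    absurd with twoOuter
    ... | i₀ , j₀ , _ , (y₀ , eq₀) , _ = ℕₚ.<⇒≱ (∣used∣ a)
          (subst₂ _≤_ (Listₚ.length-map _ (pairs (2 + m))) (Listₚ.length-map realize (used a))
            (Unique⇒length≤ unique sub))
      where
      a : ℕ
      a = component y₀
      unique : Unique (map (uncurry edge) (pairs (2 + m)))
      unique = map-Unique inj (pairs-Unique (2 + m))
        where
        inj : ∀ {π π′} → π ∈ pairs (2 + m) → π′ ∈ pairs (2 + m) → uncurry edge π ≡ uncurry edge π′ → π ≡ π′
        inj p p′ eq with edge-inj (∈-pairs⁻ p) (∈-pairs⁻ p′) eq
        ... | refl , refl = refl
      blkUsed : ∀ b t {i y} → core i ≡ wv y → core i ∈ₛ realize (blk b t) → blk b t ∈ used a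
      blkUsed b t {i} {y} p i∈ = Memₚ.∈-++⁺ʳ links (Memₚ.∈-cartesianProductWith⁺ blk
        (subst (λ z → b ∈ members z)
          (trans (sym (consistent (∈-++⁻ʳ (subst (_∈ₛ realize (blk b t)) p i∈)))) (outerComponent p eq₀))
          (∈members b))
        (Memₚ.∈-allFin t))
      centreUnique : ∀ b {t r i} → core i ≡ cv r → core i ∈ₛ realize (blk b t) → r ≡ t
      centreUnique b {t} p i∈ = Subₚ.x∈⁅y⁆⇒x≡y t (∈-++⁻ˡ (subst (_∈ₛ realize (blk b t)) p i∈))
      -- A block edge has only one centre, so one of two distinct core vertices on it is outer, and
      -- the block belongs to the component `a` of that vertex.
      isUsed : ∀ {i j} c → Valid c → i ≢ j → core i ∈ₛ realize c → core j ∈ₛ realize c → c ∈ used a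
      isUsed .(link _ _) (link s<t) _ _ _ = Memₚ.∈-++⁺ˡ (Memₚ.∈-map⁺ (uncurry link) (∈-pairs⁺ s<t))
      isUsed {i} {j} .(blk b t) (blk b t) i≢j i∈ j∈ = cases (split m (core i)) (split m (core j)) refl refl
        where
        cases : ∀ {z z′} → Split m {w} z → Split m {w} z′ → core i ≡ z → core j ≡ z′ → blk b t ∈ used a
        cases (inʳ y) _ p _ = blkUsed b t p i∈
        cases (inˡ _) (inʳ y) _ q = blkUsed b t q j∈
        cases (inˡ r) (inˡ r′) p q = contradiction
          (core-inj (trans p (trans (cong cv (trans (centreUnique b p i∈) (sym (centreUnique b q j∈)))) (sym q)))) i≢j
      sub : ∀ {e} → e ∈ map (uncurry edge) (pairs (2 + m)) → e ∈ map realize (used a)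
      sub e∈ with Memₚ.∈-map⁻ (uncurry edge) e∈
      ... | (i , j) , ij∈ , refl with ∈-pairs⁻ ij∈
      ... | i<j with Memₚ.∈-map⁻ realize (edge∈ i<j)
      ... | c , c∈ , eq = subst (_∈ map realize (used a)) (sym eq) (Memₚ.∈-map⁺ realize
              (isUsed c (valid c∈) (Finₚ.<⇒≢ i<j) (subst (core i ∈ₛ_) eq (left∈ i<j)) (subst (core j ∈ₛ_) eq (right∈ i<j))))

  base-free : ¬ ContainsBergeK (2 + m) (edges base)
  base-free c = Free.absurd (toBergeClique (simple base) c)

  module _ (e : Subset (m + w)) (e∉ : e ∉ edges base) where

    -- `nothing` is the name of the new edge `e`.
    realize⁺ : Maybe Code → Subset (m + w)
    realize⁺ nothing = e
    realize⁺ (just c) = realize c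

    Valid⁺ : Maybe Code → Set
    Valid⁺ c = ∀ {c′} → c ≡ just c′ → c′ ∈ codes

    realize⁺-inj : ∀ {c c′} → Valid⁺ c → Valid⁺ c′ → realize⁺ c ≡ realize⁺ c′ → c ≡ c′
    realize⁺-inj {nothing} {nothing} _ _ _ = refl
    realize⁺-inj {nothing} {just c′} _ v′ eq = contradiction (subst (_∈ edges base) (sym eq) (Memₚ.∈-map⁺ realize (v′ refl))) e∉
    realize⁺-inj {just c} {nothing} v _ eq = contradiction (subst (_∈ edges base) eq (Memₚ.∈-map⁺ realize (v refl))) e∉
    realize⁺-inj {just c} {just c′} v v′ eq = cong just (realize-inj (valid (v refl)) (valid (v′ refl)) eq)

    realize⁺∈ : ∀ {c} → Valid⁺ c → realize⁺ c ∈ e ∷ edges base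
    realize⁺∈ {nothing} _ = here refl
    realize⁺∈ {just c} v = there (Memₚ.∈-map⁺ realize (v refl))

    module _ {α β : Fin w} (α≢β : α ≢ β) where

      -- The core of all cliques to be built: two outer vertices, then all centres.
      hub : Fin (2 + m) → Fin (m + w)
      hub zero = wv α
      hub (suc zero) = wv β
      hub (suc (suc t)) = cv t

      cv≢wv : ∀ t y → cv t ≢ wv y
      cv≢wv t y eq with trans (sym (Finₚ.splitAt-↑ˡ m t w)) (trans (cong (splitAt m) eq) (Finₚ.splitAt-↑ʳ m w y))
      ... | ()

      hub-inj : ∀ {i j} → hub i ≡ hub j → i ≡ j
      hub-inj {zero} {zero} _ = refl
      hub-inj {zero} {suc zero} eq = contradiction (Finₚ.↑ʳ-injective m α β eq) α≢β
      hub-inj {zero} {suc (suc t)} eq = contradiction (sym eq) (cv≢wv t α)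
      hub-inj {suc zero} {zero} eq = contradiction (sym (Finₚ.↑ʳ-injective m β α eq)) α≢β
      hub-inj {suc zero} {suc zero} _ = refl
      hub-inj {suc zero} {suc (suc t)} eq = contradiction (sym eq) (cv≢wv t β)
      hub-inj {suc (suc s)} {zero} eq = contradiction eq (cv≢wv s α)
      hub-inj {suc (suc s)} {suc zero} eq = contradiction eq (cv≢wv s β)
      hub-inj {suc (suc s)} {suc (suc t)} eq = cong (λ z → suc (suc z)) (Finₚ.↑ˡ-injective w s t eq)

      Fits : Maybe Code → Fin (2 + m) → Fin (2 + m) → Set
      Fits c i j = Valid⁺ c × hub i ∈ₛ realize⁺ c × hub j ∈ₛ realize⁺ c

      -- Distinct pairs get distinct edges because `decode` recovers the pair from its code.
      hubClique : (code : Fin (2 + m) → Fin (2 + m) → Maybe Code) (decode : Maybe Code → Fin (2 + m) × Fin (2 + m)) →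
        (∀ i j → i < j → decode (code i j) ≡ (i , j) × Fits (code i j) i j) → BergeClique (2 + m) (e ∷ edges base)
      hubClique code decode ok = record
        { core = hub ; core-inj = hub-inj ; edge = λ i j → realize⁺ (code i j)
        ; edge∈ = λ p → realize⁺∈ (proj₁ (proj₂ (ok _ _ p)))
        ; left∈ = λ p → proj₁ (proj₂ (proj₂ (ok _ _ p)))
        ; right∈ = λ p → proj₂ (proj₂ (proj₂ (ok _ _ p)))
        ; edge-inj = λ p p′ eq → inj p p′ (realize⁺-inj (proj₁ (proj₂ (ok _ _ p))) (proj₁ (proj₂ (ok _ _ p′))) eq) }
        where
        inj : ∀ {i j i′ j′} → i < j → i′ < j′ → code i j ≡ code i′ j′ → i ≡ i′ × j ≡ j′
        inj p p′ eq with trans (sym (proj₁ (ok _ _ p))) (trans (cong decode eq) (proj₁ (ok _ _ p′)))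
        ... | refl = refl , refl

      fits-blk : ∀ {y b t} → y ∈ₛ block b → Valid⁺ (just (blk b t)) × wv y ∈ₛ realize (blk b t) × cv t ∈ₛ realize (blk b t)
      fits-blk {y} {b} {t} y∈ = (λ { refl → blk∈codes b t }) , ∈-++⁺ʳ y∈ , ∈-++⁺ˡ (Subₚ.x∈⁅x⁆ t)

      fits-link : ∀ {s t : Fin m} → s < t → Valid⁺ (just (link s t)) × cv s ∈ₛ realize (link s t) × cv t ∈ₛ realize (link s t)
      fits-link {s} {t} s<t = (λ { refl → link∈codes s<t }) , ∈-++⁺ˡ (s∈⁅s,t⁆ s t) , ∈-++⁺ˡ (t∈⁅s,t⁆ s t)

    -- `e` serves αβ, the blocks of α and β serve their pairs with centres, and the links serve the
    -- pairs of centres. The two blocks differ as they lie in different components.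
    outerClique : ∀ {α β} → wv α ∈ₛ e → wv β ∈ₛ e → component α ≢ component β → BergeClique (2 + m) (e ∷ edges base)
    outerClique {α} {β} α∈ β∈ α≁β = hubClique α≢β code decode ok
      where
      α≢β : α ≢ β
      α≢β eq = α≁β (cong component eq)
      bα bβ : Fin #blocks
      bα = proj₁ (cover α)
      bβ = proj₁ (cover β)
      bβ≢bα : bβ ≢ bα
      bβ≢bα eq = α≁β (trans (consistent (proj₂ (cover α)))
        (trans (cong bcomponent (sym eq)) (sym (consistent (proj₂ (cover β))))))
      code : Fin (2 + m) → Fin (2 + m) → Maybe Code
      code zero (suc (suc t)) = just (blk bα t)
      code (suc zero) (suc (suc t)) = just (blk bβ t)
      code (suc (suc s)) (suc (suc t)) = just (link s t)
      -- Among increasing pairs only αβ falls through to this clause.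
      code _ _ = nothing
      decode : Maybe Code → Fin (2 + m) × Fin (2 + m)
      decode nothing = zero , suc zero
      decode (just (link s t)) = suc (suc s) , suc (suc t)
      decode (just (blk b t)) with b Finₚ.≟ bα
      ... | yes _ = zero , suc (suc t)
      ... | no _ = suc zero , suc (suc t)
      ok : ∀ i j → i < j → decode (code i j) ≡ (i , j) × Fits α≢β (code i j) i j
      ok zero (suc zero) _ = refl , (λ ()) , α∈ , β∈
      ok zero (suc (suc t)) _ with bα Finₚ.≟ bα
      ... | yes _ = refl , fits-blk α≢β (proj₂ (cover α))
      ... | no ≢ = contradiction refl ≢
      ok (suc zero) (suc (suc t)) _ with bβ Finₚ.≟ bα
      ... | yes eq = contradiction eq bβ≢bα
      ... | no _ = refl , fits-blk α≢β (proj₂ (cover β))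
      ok (suc zero) (suc zero) (s≤s ())
      ok (suc (suc s)) (suc zero) (s≤s ())
      ok (suc (suc s)) (suc (suc t)) (s≤s (s≤s p)) = refl , fits-link α≢β p

    -- As e serves the pair of centres i₀ j₀, link i₀ j₀ is free for x i₀, and blk b₁ i₀ for x v.
    centreClique : ∀ {i₀ j₀} → i₀ < j₀ → cv i₀ ∈ₛ e → cv j₀ ∈ₛ e → BergeClique (2 + m) (e ∷ edges base)
    centreClique {i₀} {j₀} i₀<j₀ i₀∈ j₀∈ = hubClique x≢v code decode ok
      where
      code : Fin (2 + m) → Fin (2 + m) → Maybe Code
      code zero (suc zero) = just (blk b₁ i₀)
      code zero (suc (suc t)) with t Finₚ.≟ i₀
      ... | yes _ = just (link i₀ j₀)
      ... | no _ = just (blk b₁ t)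
      -- v lies in both blocks; using `b₂` for it leaves the edges over `b₁` to x and to the pair
      -- xv.
      code (suc zero) (suc (suc t)) = just (blk b₂ t)
      code (suc (suc s)) (suc (suc t)) with (s Finₚ.≟ i₀) ×-dec (t Finₚ.≟ j₀)
      ... | yes _ = nothing
      ... | no _ = just (link s t)
      -- No increasing pair reaches this clause.
      code _ _ = nothing
      decode : Maybe Code → Fin (2 + m) × Fin (2 + m)
      decode nothing = suc (suc i₀) , suc (suc j₀)
      decode (just (link s t)) with (s Finₚ.≟ i₀) ×-dec (t Finₚ.≟ j₀)
      ... | yes _ = zero , suc (suc i₀)
      ... | no _ = suc (suc s) , suc (suc t)
      decode (just (blk b t)) with b Finₚ.≟ b₁ | t Finₚ.≟ i₀
      ... | yes _ | yes _ = zero , suc zero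
      ... | yes _ | no _ = zero , suc (suc t)
      ... | no _ | _ = suc zero , suc (suc t)
      decode-xv : decode (just (blk b₁ i₀)) ≡ (zero , suc zero)
      decode-xv with b₁ Finₚ.≟ b₁ | i₀ Finₚ.≟ i₀
      ... | yes _ | yes _ = refl
      ... | no ≢ | _ = contradiction refl ≢
      ... | yes _ | no ≢ = contradiction refl ≢
      decode-x : ∀ {t} → t ≢ i₀ → decode (just (blk b₁ t)) ≡ (zero , suc (suc t))
      decode-x {t} t≢ with b₁ Finₚ.≟ b₁ | t Finₚ.≟ i₀
      ... | yes _ | yes eq = contradiction eq t≢
      ... | no ≢ | _ = contradiction refl ≢
      ... | yes _ | no _ = refl
      decode-v : ∀ t → decode (just (blk b₂ t)) ≡ (suc zero , suc (suc t))
      decode-v t with b₂ Finₚ.≟ b₁ | t Finₚ.≟ i₀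
      ... | yes eq | _ = contradiction (sym eq) b₁≢b₂
      ... | no _ | _ = refl
      decode-x₀ : decode (just (link i₀ j₀)) ≡ (zero , suc (suc i₀))
      decode-x₀ with (i₀ Finₚ.≟ i₀) ×-dec (j₀ Finₚ.≟ j₀)
      ... | yes _ = refl
      ... | no ≢ = contradiction (refl , refl) ≢
      decode-link : ∀ {s t} → ¬ (s ≡ i₀ × t ≡ j₀) → decode (just (link s t)) ≡ (suc (suc s) , suc (suc t))
      decode-link {s} {t} ≢ with (s Finₚ.≟ i₀) ×-dec (t Finₚ.≟ j₀)
      ... | yes eq = contradiction eq ≢
      ... | no _ = refl
      ok : ∀ i j → i < j → decode (code i j) ≡ (i , j) × Fits x≢v (code i j) i j
      ok zero (suc zero) _ = decode-xv , (λ { refl → blk∈codes b₁ i₀ }) , ∈-++⁺ʳ x∈b₁ , ∈-++⁺ʳ v∈b₁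
      ok zero (suc (suc t)) _ with t Finₚ.≟ i₀
      ... | yes refl = decode-x₀ , (λ { refl → link∈codes i₀<j₀ }) , ∈-++⁺ʳ x∈pad , ∈-++⁺ˡ (s∈⁅s,t⁆ i₀ j₀)
      ... | no t≢ = decode-x t≢ , fits-blk x≢v x∈b₁
      ok (suc zero) (suc (suc t)) _ = decode-v t , fits-blk x≢v v∈b₂
      ok (suc zero) (suc zero) (s≤s ())
      ok (suc (suc s)) (suc zero) (s≤s ())
      ok (suc (suc s)) (suc (suc t)) (s≤s (s≤s p)) with (s Finₚ.≟ i₀) ×-dec (t Finₚ.≟ j₀)
      ... | yes (refl , refl) = refl , (λ ()) , i₀∈ , j₀∈
      ... | no ≢ = decode-link ≢ , fits-link x≢v p

  -- Two centres in `e`, or an outer vertex in a component other than that of `u`, give a clique.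
  -- Otherwise `e` has at most one centre and its outer part lies in the single block of `u`, so
  -- size k forces one centre and the whole block, which is a base edge.
  genericEdge : ∀ e → ∣ e ∣ ≡ 2 + p′ → e ∉ edges base → ∀ u → wv u ∈ₛ e → 2 ≤ component u → BergeClique (2 + m) (e ∷ edges base)
  genericEdge e size e∉ u u∈ generic with Vec.splitAt m e
  ... | c , q , refl with Finₚ.any? (λ i → Finₚ.any? λ j → (i Finₚ.<? j) ×-dec ((i Subₚ.∈? c) ×-dec (j Subₚ.∈? c)))
  ... | yes (i , j , i<j , i∈ , j∈) = centreClique _ e∉ i<j (∈-++⁺ˡ i∈) (∈-++⁺ˡ j∈)
  ... | no ¬pair with Finₚ.any? (λ y → (y Subₚ.∈? q) ×-dec ¬? (component u ℕₚ.≟ component y))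
  ... | yes (y , y∈ , u≁y) = outerClique _ e∉ u∈ (∈-++⁺ʳ y∈) u≁y
  ... | no ¬other = ⊥-elim (absurd (Subₚ.nonempty? c))
    where
    bu : Fin #blocks
    bu = proj₁ (cover u)
    u-comp : component u ≡ bcomponent bu
    u-comp = consistent (proj₂ (cover u))
    q⊆ : q ⊆ₛ block bu
    q⊆ {y} y∈ with component u ℕₚ.≟ component y
    ... | no ≢ = contradiction (y , y∈ , ≢) ¬other
    ... | yes eq = subst (λ b → y ∈ₛ block b) (sym (generic-inj (subst (2 ≤_) u-comp generic)
          (trans (sym u-comp) (trans eq (consistent (proj₂ (cover y))))))) (proj₂ (cover y))
    ∣q∣≤ : ∣ q ∣ ≤ suc p′
    ∣q∣≤ = subst (∣ q ∣ ≤_) (∣block∣ bu) (Subₚ.p⊆q⇒∣p∣≤∣q∣ q⊆)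
    size′ : ∣ c ∣ + ∣ q ∣ ≡ 2 + p′
    size′ = trans (sym (∣p++q∣ c q)) size
    absurd : Dec (Nonempty c) → ⊥
    absurd (no ¬ne) = ℕₚ.<⇒≱ (ℕₚ.n<1+n (suc p′)) (subst (_≤ suc p′)
      (trans (cong (_+ ∣ q ∣) (sym (trans (cong ∣_∣ (Subₚ.Empty-unique ¬ne)) (Subₚ.∣⊥∣≡0 m)))) size′) ∣q∣≤)
    absurd (yes (t , t∈)) = e∉ (subst (_∈ edges base) (cong₂ _⧺_ (sym c≡) (sym q≡)) (Memₚ.∈-map⁺ realize (blk∈codes bu t)))
      where
      only : ∀ {i} → i ∈ₛ c → i ≡ t
      only {i} i∈ with i Finₚ.≟ t
      ... | yes eq = eq
      ... | no i≢t with ℕₚ.<-cmp (toℕ i) (toℕ t)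
      ... | tri< p _ _ = contradiction (i , t , p , i∈ , t∈) ¬pair
      ... | tri≈ _ p _ = Finₚ.toℕ-injective p
      ... | tri> _ _ p = contradiction (t , i , p , t∈ , i∈) ¬pair
      c≡ : c ≡ ⁅ t ⁆
      c≡ = Subₚ.⊆-antisym (λ i∈ → subst (_∈ₛ ⁅ t ⁆) (sym (only i∈)) (Subₚ.x∈⁅x⁆ t))
        (λ i∈ → subst (_∈ₛ c) (sym (Subₚ.x∈⁅y⁆⇒x≡y t i∈)) t∈)
      q≡ : q ≡ block bu
      q≡ = ⊆∧∣∣≡⇒≡ q⊆ (trans (ℕₚ.suc-injective (trans (cong (_+ ∣ q ∣) (sym (trans (cong ∣_∣ c≡) (Subₚ.∣⁅x⁆∣≡1 t)))) size′))
        (sym (∣block∣ bu)))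

  private
    allCandidates : List (Subset (m + w))
    allCandidates = cartesianProductWith _⧺_ (allSubsets m) candidates

    ∈allCandidates : ∀ e → (∀ y → wv y ∈ₛ e → component y ℕ.< 2) → e ∈ allCandidates
    ∈allCandidates e small with Vec.splitAt m e
    ... | c , q , refl = Memₚ.∈-cartesianProductWith⁺ _⧺_ (∈-allSubsets c) (∈candidates q λ y y∈ → small y (∈-++⁺ʳ y∈))

  -- A non-edge with a vertex in a generic component completes a clique with base edges alone; every
  -- other set is among the candidates of the greedy completion.
  saturatedHypergraph : ∃ λ (H : Hypergraph (2 + p′) (m + w)) → Saturated (2 + m) H ×
    numEdges H ≤ 2 ^ m * length candidates + (#blocks * m + length (pairs m))
  saturatedHypergraph = finish (complete (2 + p′) m allCandidates base base-free)
    where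
    open ℕₚ.≤-Reasoning
    finish : (∃ λ (H : Hypergraph (2 + p′) (m + w)) → ¬ ContainsBergeK (2 + m) (edges H) ×
      (∀ {e} → e ∈ edges base → e ∈ edges H) ×
      (∀ {e} → e ∈ allCandidates → ∣ e ∣ ≡ 2 + p′ → e ∉ edges H → ContainsBergeK (2 + m) (e ∷ edges H)) ×
      numEdges H ≤ length allCandidates + numEdges base) →
      ∃ λ (H : Hypergraph (2 + p′) (m + w)) → Saturated (2 + m) H ×
        numEdges H ≤ 2 ^ m * length candidates + (#blocks * m + length (pairs m))
    finish (H , free , base⊆ , sat , small) = H , (free , saturated) , (begin
      numEdges H ≤⟨ small ⟩
      length allCandidates + numEdges base
        ≡⟨ cong₂ _+_ (trans (length-cartesianProductWith _⧺_ (allSubsets m) candidates)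
                       (cong (_* length candidates) (length-allSubsets m))) numEdges-base ⟩
      2 ^ m * length candidates + (#blocks * m + length (pairs m)) ∎)
      where
      saturated : ∀ e → ∣ e ∣ ≡ 2 + p′ → e ∉ edges H → ContainsBergeK (2 + m) (e ∷ edges H)
      saturated e size e∉ with Finₚ.any? (λ y → (wv y Subₚ.∈? e) ×-dec (2 ℕₚ.≤? component y))
      ... | yes (u , u∈ , generic) = fromBergeClique (BergeClique-⊆
            (λ { (here refl) → here refl ; (there p) → there (base⊆ p) }) (genericEdge e size (e∉ ∘ base⊆) u u∈ generic))
      ... | no none = sat (∈allCandidates e λ y y∈ → ℕₚ.≰⇒> λ generic → none (y , y∈ , generic)) size e∉

-- Explicit blocks on the vertices outside the centres.

module OverlappingPair (a o : ℕ) where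

  size : ℕ
  size = a + (o + a)

  -- Three segments of lengths a, o, a; the middle one is the overlap.
  left right : Subset size
  left = full {a} ⧺ (full {o} ⧺ ∅ {a})
  right = ∅ {a} ⧺ (full {o} ⧺ full {a})

  ∣left∣ : ∣ left ∣ ≡ a + o
  ∣left∣ = trans (∣p++q∣ (full {a}) _) (cong₂ _+_ (Subₚ.∣⊤∣≡n a)
    (trans (∣p++q∣ (full {o}) (∅ {a})) (trans (cong₂ _+_ (Subₚ.∣⊤∣≡n o) (Subₚ.∣⊥∣≡0 a)) (ℕₚ.+-identityʳ o))))

  ∣right∣ : ∣ right ∣ ≡ a + o
  ∣right∣ = trans (∣p++q∣ (∅ {a}) _) (trans (cong₂ _+_ (Subₚ.∣⊥∣≡0 a)
    (trans (∣p++q∣ (full {o}) (full {a})) (cong₂ _+_ (Subₚ.∣⊤∣≡n o) (Subₚ.∣⊤∣≡n a)))) (ℕₚ.+-comm o a))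

  covered : ∀ z → z ∈ₛ left ⊎ z ∈ₛ right
  covered z with split a z
  ... | inˡ i = inj₁ (∈-++⁺ˡ Subₚ.∈⊤)
  ... | inʳ z′ with split o z′
  ... | inˡ i = inj₁ (∈-++⁺ʳ {p = full {a}} (∈-++⁺ˡ Subₚ.∈⊤))
  ... | inʳ j = inj₂ (∈-++⁺ʳ {p = ∅ {a}} (∈-++⁺ʳ {p = full {o}} Subₚ.∈⊤))

-- The private part is nonempty, so the first vertex lies in `left` only.
left≢right : ∀ a o → OverlappingPair.left (suc a) o ≢ OverlappingPair.right (suc a) o
left≢right a o ()

module Chunks (p : ℕ) where

  chunk : ∀ t → Fin t → Subset (t * p)
  chunk (suc t) zero = full {p} ⧺ ∅
  chunk (suc t) (suc i) = ∅ {p} ⧺ chunk t i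

  index : ∀ t → Fin (t * p) → Fin t
  index (suc t) z with split p z
  ... | inˡ _ = zero
  ... | inʳ z′ = suc (index t z′)

  ∣chunk∣ : ∀ t i → ∣ chunk t i ∣ ≡ p
  ∣chunk∣ (suc t) zero = trans (∣p++q∣ (full {p}) (∅ {t * p}))
    (trans (cong₂ _+_ (Subₚ.∣⊤∣≡n p) (Subₚ.∣⊥∣≡0 (t * p))) (ℕₚ.+-identityʳ p))
  ∣chunk∣ (suc t) (suc i) = trans (∣p++q∣ (∅ {p}) (chunk t i)) (cong₂ _+_ (Subₚ.∣⊥∣≡0 p) (∣chunk∣ t i))

  ∈chunk : ∀ t z → z ∈ₛ chunk t (index t z)
  ∈chunk (suc t) z with split p z
  ... | inˡ _ = ∈-++⁺ˡ Subₚ.∈⊤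
  ... | inʳ z′ = ∈-++⁺ʳ {p = ∅ {p}} (∈chunk t z′)

  ∈chunk⇒index : ∀ t i z → z ∈ₛ chunk t i → index t z ≡ i
  ∈chunk⇒index (suc t) zero z z∈ with split p z
  ... | inˡ _ = refl
  ... | inʳ z′ = contradiction (∈-++⁻ʳ {p = full {p}} z∈) Subₚ.∉⊥
  ∈chunk⇒index (suc t) (suc i) z z∈ with split p z
  ... | inˡ _ = contradiction (∈-++⁻ˡ {p = ∅ {p}} z∈) Subₚ.∉⊥
  ... | inʳ z′ = cong suc (∈chunk⇒index t i z′ (∈-++⁻ʳ {p = ∅ {p}} z∈))

module Blocks (p″ a′ o t : ℕ) (a+o≡p : suc a′ + o ≡ 2 + p″) where
  p′ : ℕ
  p′ = suc p″
  -- The first pair overlaps in the single vertex v. The overlap `o` of the second pair is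
  -- adjustable, to reach every residue of the vertex count modulo k - 1.
  module First = OverlappingPair p′ 1
  module Second = OverlappingPair (suc a′) o
  open Chunks (suc p′)

  w : ℕ
  w = First.size + (Second.size + t * suc p′)

  component : Fin w → ℕ
  component y with split First.size y
  ... | inˡ _ = 0
  ... | inʳ z with split Second.size z
  ... | inˡ _ = 1
  ... | inʳ g = 2 + toℕ (index t g)

  block : Fin (4 + t) → Subset w
  block zero = First.left ⧺ ∅
  block (suc zero) = First.right ⧺ ∅
  block (suc (suc zero)) = ∅ {First.size} ⧺ (Second.left ⧺ ∅)
  block (suc (suc (suc zero))) = ∅ {First.size} ⧺ (Second.right ⧺ ∅)
  block (suc (suc (suc (suc i)))) = ∅ {First.size} ⧺ (∅ {Second.size} ⧺ chunk t i)

  bcomponent : Fin (4 + t) → ℕ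
  bcomponent zero = 0
  bcomponent (suc zero) = 0
  bcomponent (suc (suc zero)) = 1
  bcomponent (suc (suc (suc zero))) = 1
  bcomponent (suc (suc (suc (suc i)))) = 2 + toℕ i

  ∣s++∅∣ : (s : Subset m) → ∣ s ⧺ ∅ {n} ∣ ≡ ∣ s ∣
  ∣s++∅∣ {n = n} s = trans (∣p++q∣ s ∅) (trans (cong (∣ s ∣ +_) (Subₚ.∣⊥∣≡0 n)) (ℕₚ.+-identityʳ _))

  ∣∅++s∣ : (s : Subset n) → ∣ ∅ {m} ⧺ s ∣ ≡ ∣ s ∣
  ∣∅++s∣ {m = m} s = trans (∣p++q∣ (∅ {m}) s) (cong (_+ ∣ s ∣) (Subₚ.∣⊥∣≡0 m))

  p′+1≡p : p′ + 1 ≡ suc p′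
  p′+1≡p = ℕₚ.+-comm p′ 1

  ∣block∣ : ∀ b → ∣ block b ∣ ≡ suc p′
  ∣block∣ zero = trans (∣s++∅∣ First.left) (trans First.∣left∣ p′+1≡p)
  ∣block∣ (suc zero) = trans (∣s++∅∣ First.right) (trans First.∣right∣ p′+1≡p)
  ∣block∣ (suc (suc zero)) = trans (∣∅++s∣ {m = First.size} _) (trans (∣s++∅∣ Second.left) (trans Second.∣left∣ a+o≡p))
  ∣block∣ (suc (suc (suc zero))) = trans (∣∅++s∣ {m = First.size} _) (trans (∣s++∅∣ Second.right) (trans Second.∣right∣ a+o≡p))
  ∣block∣ (suc (suc (suc (suc i)))) = trans (∣∅++s∣ {m = First.size} _) (trans (∣∅++s∣ {m = Second.size} _) (∣chunk∣ t i))

  component-first : (s : Subset First.size) → ∀ {y} → y ∈ₛ s ⧺ ∅ → component y ≡ 0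
  component-first s {y} y∈ with split First.size y
  ... | inˡ _ = refl
  ... | inʳ z = contradiction (∈-++⁻ʳ {p = s} y∈) Subₚ.∉⊥

  component-second : (s : Subset Second.size) → ∀ {y} → y ∈ₛ ∅ {First.size} ⧺ (s ⧺ ∅) → component y ≡ 1
  component-second s {y} y∈ with split First.size y
  ... | inˡ _ = contradiction (∈-++⁻ˡ {p = ∅ {First.size}} y∈) Subₚ.∉⊥
  ... | inʳ z with split Second.size z
  ... | inˡ _ = refl
  ... | inʳ _ = contradiction (∈-++⁻ʳ {p = s} (∈-++⁻ʳ {p = ∅ {First.size}} y∈)) Subₚ.∉⊥

  component-chunk : ∀ i {y} → y ∈ₛ block (suc (suc (suc (suc i)))) → component y ≡ 2 + toℕ i
  component-chunk i {y} y∈ with split First.size y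
  ... | inˡ _ = contradiction (∈-++⁻ˡ {p = ∅ {First.size}} y∈) Subₚ.∉⊥
  ... | inʳ z with split Second.size z
  ... | inˡ _ = contradiction (∈-++⁻ˡ {p = ∅ {Second.size}} (∈-++⁻ʳ {p = ∅ {First.size}} y∈)) Subₚ.∉⊥
  ... | inʳ g = cong (λ j → 2 + toℕ j) (∈chunk⇒index t i g (∈-++⁻ʳ {p = ∅ {Second.size}} (∈-++⁻ʳ {p = ∅ {First.size}} y∈)))

  consistent : ∀ {b y} → y ∈ₛ block b → component y ≡ bcomponent b
  consistent {zero} = component-first First.left
  consistent {suc zero} = component-first First.right
  consistent {suc (suc zero)} = component-second Second.left
  consistent {suc (suc (suc zero))} = component-second Second.right
  consistent {suc (suc (suc (suc i)))} = component-chunk i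

  cover : ∀ y → ∃ λ b → y ∈ₛ block b
  cover y with split First.size y
  ... | inˡ i with First.covered i
  ... | inj₁ i∈ = zero , ∈-++⁺ˡ i∈
  ... | inj₂ i∈ = suc zero , ∈-++⁺ˡ i∈
  cover y | inʳ z with split Second.size z
  ... | inʳ g = suc (suc (suc (suc (index t g)))) , ∈-++⁺ʳ {p = ∅ {First.size}} (∈-++⁺ʳ {p = ∅ {Second.size}} (∈chunk t g))
  ... | inˡ i with Second.covered i
  ... | inj₁ i∈ = suc (suc zero) , ∈-++⁺ʳ {p = ∅ {First.size}} (∈-++⁺ˡ i∈)
  ... | inj₂ i∈ = suc (suc (suc zero)) , ∈-++⁺ʳ {p = ∅ {First.size}} (∈-++⁺ˡ i∈)

  block-nonempty : ∀ b → Nonempty (block b)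
  block-nonempty b with Subₚ.nonempty? (block b)
  ... | yes ne = ne
  ... | no ¬ne = contradiction (trans (sym (∣block∣ b)) (trans (cong ∣_∣ (Subₚ.Empty-unique ¬ne)) (Subₚ.∣⊥∣≡0 w))) λ ()

  -- Blocks are nonempty, so equal blocks share a vertex and thus a component. Inside a component
  -- only the two sides of an overlapping pair need to be told apart.
  block-inj : ∀ {b b′} → block b ≡ block b′ → b ≡ b′
  block-inj {b} {b′} eq = same b b′ (trans (sym (consistent {b} y∈)) (consistent {b′} (subst (y ∈ₛ_) eq y∈))) eq
    where
    y : Fin w
    y = proj₁ (block-nonempty b)
    y∈ : y ∈ₛ block b
    y∈ = proj₂ (block-nonempty b)
    left≢right₁ : block zero ≢ block (suc zero)
    left≢right₁ q = left≢right p″ 1 (proj₁ (Vecₚ.++-injective First.left First.right q))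
    left≢right₂ : block (suc (suc zero)) ≢ block (suc (suc (suc zero)))
    left≢right₂ q = left≢right a′ o
      (proj₁ (Vecₚ.++-injective Second.left Second.right (proj₂ (Vecₚ.++-injective (∅ {First.size}) ∅ q))))
    same : ∀ b b′ → bcomponent b ≡ bcomponent b′ → block b ≡ block b′ → b ≡ b′
    same zero zero _ _ = refl
    same zero (suc zero) _ q = contradiction q left≢right₁
    same (suc zero) zero _ q = contradiction (sym q) left≢right₁
    same (suc zero) (suc zero) _ _ = refl
    same (suc (suc zero)) (suc (suc zero)) _ _ = refl
    same (suc (suc zero)) (suc (suc (suc zero))) _ q = contradiction q left≢right₂
    same (suc (suc (suc zero))) (suc (suc zero)) _ q = contradiction (sym q) left≢right₂
    same (suc (suc (suc zero))) (suc (suc (suc zero))) _ _ = refl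
    same (suc (suc (suc (suc i)))) (suc (suc (suc (suc j)))) r _ =
      cong (λ z → suc (suc (suc (suc z)))) (Finₚ.toℕ-injective (ℕₚ.suc-injective (ℕₚ.suc-injective r)))
    same zero (suc (suc zero)) () _
    same zero (suc (suc (suc zero))) () _
    same zero (suc (suc (suc (suc _)))) () _
    same (suc zero) (suc (suc zero)) () _
    same (suc zero) (suc (suc (suc zero))) () _
    same (suc zero) (suc (suc (suc (suc _)))) () _
    same (suc (suc zero)) zero () _
    same (suc (suc zero)) (suc zero) () _
    same (suc (suc zero)) (suc (suc (suc (suc _)))) () _
    same (suc (suc (suc zero))) zero () _
    same (suc (suc (suc zero))) (suc zero) () _
    same (suc (suc (suc zero))) (suc (suc (suc (suc _)))) () _
    same (suc (suc (suc (suc _)))) zero () _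
    same (suc (suc (suc (suc _)))) (suc zero) () _
    same (suc (suc (suc (suc _)))) (suc (suc zero)) () _
    same (suc (suc (suc (suc _)))) (suc (suc (suc zero))) () _

  generic-inj : ∀ {b b′} → 2 ≤ bcomponent b → bcomponent b ≡ bcomponent b′ → b ≡ b′
  generic-inj {suc (suc (suc (suc i)))} {suc (suc (suc (suc j)))} _ r =
    cong (λ z → suc (suc (suc (suc z)))) (Finₚ.toℕ-injective (ℕₚ.suc-injective (ℕₚ.suc-injective r)))
  generic-inj {zero} () _
  generic-inj {suc zero} () _
  generic-inj {suc (suc zero)} (s≤s ()) _
  generic-inj {suc (suc (suc zero))} (s≤s ()) _
  generic-inj {suc (suc (suc (suc _)))} {zero} _ ()
  generic-inj {suc (suc (suc (suc _)))} {suc zero} _ ()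
  generic-inj {suc (suc (suc (suc _)))} {suc (suc zero)} _ ()
  generic-inj {suc (suc (suc (suc _)))} {suc (suc (suc zero))} _ ()

  members : ℕ → List (Fin (4 + t))
  members 0 = zero ∷ suc zero ∷ []
  members 1 = suc (suc zero) ∷ suc (suc (suc zero)) ∷ []
  members (suc (suc c)) with c ℕₚ.<? t
  ... | yes c<t = suc (suc (suc (suc (Fin.fromℕ< c<t)))) ∷ []
  ... | no _ = []

  ∈members : ∀ b → b ∈ members (bcomponent b)
  ∈members zero = here refl
  ∈members (suc zero) = there (here refl)
  ∈members (suc (suc zero)) = here refl
  ∈members (suc (suc (suc zero))) = there (here refl)
  ∈members (suc (suc (suc (suc i)))) with toℕ i ℕₚ.<? t
  ... | yes i<t = here (cong (λ z → suc (suc (suc (suc z)))) (sym (Finₚ.fromℕ<-toℕ i i<t)))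
  ... | no i≮t = contradiction (Finₚ.toℕ<n i) i≮t

  ∣members∣≤2 : ∀ c → length (members c) ≤ 2
  ∣members∣≤2 0 = ℕₚ.≤-refl
  ∣members∣≤2 1 = ℕₚ.≤-refl
  ∣members∣≤2 (suc (suc c)) with c ℕₚ.<? t
  ... | yes _ = s≤s z≤n
  ... | no _ = z≤n

  -- Only the two overlapping pairs contribute, so the number of candidates does not depend on `t`.
  candidates : List (Subset w)
  candidates = cartesianProductWith (λ s s′ → s ⧺ (s′ ⧺ ∅ {t * suc p′})) (allSubsets First.size) (allSubsets Second.size)

  component-generic : ∀ g → component (First.size ↑ʳ (Second.size ↑ʳ g)) ≡ 2 + toℕ (index t g)
  component-generic g = component-chunk (index t g)
    (∈-++⁺ʳ {p = ∅ {First.size}} (∈-++⁺ʳ {p = ∅ {Second.size}} (∈chunk t g)))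

  ∈candidates : ∀ q → (∀ y → y ∈ₛ q → component y ℕ.< 2) → q ∈ candidates
  ∈candidates q small with Vec.splitAt First.size q
  ... | s , q′ , refl with Vec.splitAt Second.size q′
  ... | s′ , r , refl = subst (λ z → s ⧺ (s′ ⧺ z) ∈ candidates) (sym (Subₚ.Empty-unique empty))
        (Memₚ.∈-cartesianProductWith⁺ (λ s s′ → s ⧺ (s′ ⧺ ∅ {t * suc p′})) (∈-allSubsets s) (∈-allSubsets s′))
    where
    empty : ¬ Nonempty r
    empty (g , g∈) = ℕₚ.<⇒≱ (small _ (∈-++⁺ʳ {p = s} (∈-++⁺ʳ {p = s′} g∈)))
      (subst (2 ≤_) (sym (component-generic g)) (s≤s (s≤s z≤n)))

  length-candidates : length candidates ≡ 2 ^ First.size * 2 ^ Second.size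
  length-candidates = trans (length-cartesianProductWith _ (allSubsets First.size) (allSubsets Second.size))
    (cong₂ _*_ (length-allSubsets First.size) (length-allSubsets Second.size))

  system : BlockSystem p′ w
  system = record
    { #blocks = 4 + t ; block = block ; ∣block∣ = ∣block∣ ; block-inj = block-inj
    ; component = component ; bcomponent = bcomponent ; consistent = λ {b} → consistent {b} ; cover = cover
    ; members = members ; ∈members = ∈members ; ∣members∣≤2 = ∣members∣≤2 ; generic-inj = generic-inj
    ; b₁ = zero ; b₂ = suc zero ; b₁≢b₂ = λ ()
    -- x is the first vertex of the private part of `First.left`; v, at position p′, is the shared
    -- vertex. They differ since p′ = k - 2 ≥ 1.
    ; x = zero ; v = (p′ ↑ʳ (zero {0} ↑ˡ p′)) ↑ˡ _ ; x≢v = λ ()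
    ; x∈b₁ = here
    ; v∈b₁ = ∈-++⁺ˡ (∈-++⁺ʳ {p = full {p′}} (∈-++⁺ˡ {p = full {1}} Subₚ.∈⊤))
    ; v∈b₂ = ∈-++⁺ˡ (∈-++⁺ʳ {p = ∅ {p′}} (∈-++⁺ˡ {p = full {1}} Subₚ.∈⊤))
    -- The private part of `First.left` has k - 2 vertices, so two centres complete it to a k-set.
    ; pad = (full {p′} ⧺ ∅ {1 + p′}) ⧺ ∅
    ; ∣pad∣ = trans (∣s++∅∣ (full {p′} ⧺ ∅ {1 + p′})) (trans (∣s++∅∣ (full {p′})) (Subₚ.∣⊤∣≡n p′))
    ; x∈pad = here
    ; component-pad = component-first (full {p′} ⧺ ∅ {1 + p′})
    ; candidates = candidates ; ∈candidates = ∈candidates }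

-- Choice of parameters and the asymptotic estimate.

+-≤-split : ∀ a b {c} → a + b ≤ c → a ≤ c × b ≤ c
+-≤-split a b le = ℕₚ.m+n≤o⇒m≤o a le , ℕₚ.m+n≤o⇒n≤o a le

module Asymptotics (p″ m : ℕ) (q : ℕ) where

  -- With p = k - 1, `offset` counts the centres, the first pair and a second pair of the least size
  -- p + 1. `extra` bounds the edges whose number does not grow with n: candidates, edges over the
  -- four paired blocks, and links.
  p′ p firstSize offset extra : ℕ
  p′ = suc p″
  p = suc p′
  firstSize = p′ + (1 + p′)
  offset = (m + firstSize) + suc p
  extra = 2 ^ m * (2 ^ firstSize * 2 ^ (p + p)) + (4 * m + length (pairs m))

  -- Division of n - `offset` by p: the remainder r enlarges the second pair, the quotient t counts
  -- the generic blocks.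
  shape : ∀ {n} → offset ≤ n → ∃ λ r → ∃ λ t → r ≤ p′ × t * p ≤ n × n ≡ m + (firstSize + ((p + suc r) + t * p))
  shape {n} le = r , t , ℕ.s≤s⁻¹ (m%n<n x p) , ℕₚ.≤-trans t*p≤x (ℕₚ.m∸n≤m n offset) , (begin
      n ≡⟨ sym (ℕₚ.m+[n∸m]≡n le) ⟩
      offset + x ≡⟨ cong (offset +_) (m≡m%n+[m/n]*n x p) ⟩
      offset + (r + t * p) ≡⟨ regroup m firstSize p r (t * p) ⟩
      m + (firstSize + ((p + suc r) + t * p)) ∎)
    where
    open ≡-Reasoning
    x r t : ℕ
    x = n ∸ offset
    r = x % p
    t = x / p
    t*p≤x : t * p ≤ x
    t*p≤x = subst (t * p ≤_) (sym (m≡m%n+[m/n]*n x p)) (ℕₚ.m≤n+m (t * p) r)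
    regroup : ∀ m f p r s → ((m + f) + suc p) + (r + s) ≡ m + (f + ((p + suc r) + s))
    regroup = solve-∀

  module _ (r t : ℕ) (r≤p′ : r ≤ p′) where
    open ≡-Reasoning

    -- Two blocks of size p with private parts of r + 1 vertices overlap in the other p′ - r, and
    -- cover p + r + 1 vertices.
    o : ℕ
    o = p′ ∸ r

    a+o≡p : suc r + o ≡ p
    a+o≡p = cong suc (ℕₚ.m+[n∸m]≡n r≤p′)

    secondSize : suc r + (o + suc r) ≡ p + suc r
    secondSize = trans (sym (ℕₚ.+-assoc (suc r) o (suc r))) (cong (_+ suc r) a+o≡p)

    sparseSaturatedAt : ∃ λ (H : Hypergraph (2 + p′) (m + (firstSize + ((suc r + (o + suc r)) + t * p)))) →
      Saturated (2 + m) H × numEdges H ≤ extra + t * m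
    sparseSaturatedAt = proj₁ found , proj₁ (proj₂ found) , bound
      where
      module 𝓑 = Blocks p″ r o t a+o≡p
      found = Construction.saturatedHypergraph 𝓑.system m
      -- The second pair has at most 2p vertices, which makes the bound uniform in r.
      c≤ : length 𝓑.candidates ≤ 2 ^ firstSize * 2 ^ (p + p)
      c≤ = subst (_≤ 2 ^ firstSize * 2 ^ (p + p)) (sym 𝓑.length-candidates) (ℕₚ.*-monoʳ-≤ (2 ^ firstSize)
        (ℕₚ.^-monoʳ-≤ 2 (subst (_≤ p + p) (sym secondSize) (ℕₚ.+-monoʳ-≤ p (s≤s r≤p′)))))
      regroup : ∀ c t m l → c + ((4 + t) * m + l) ≡ (c + (4 * m + l)) + t * m
      regroup = solve-∀
      bound : numEdges (proj₁ found) ≤ extra + t * m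
      bound = ℕₚ.≤-trans (proj₂ (proj₂ found)) (ℕₚ.≤-trans
        (ℕₚ.+-monoˡ-≤ ((4 + t) * m + length (pairs m)) (ℕₚ.*-monoʳ-≤ (2 ^ m) c≤))
        (ℕₚ.≤-reflexive (regroup (2 ^ m * (2 ^ firstSize * 2 ^ (p + p))) t m (length (pairs m)))))

  sparseSaturated : ∀ {n} → offset ≤ n → ∃ λ (H : Hypergraph (2 + p′) n) → Saturated (2 + m) H ×
    numEdges H * p ≤ m * n + extra * p
  sparseSaturated {n} le = build (shape le)
    where
    open ℕₚ.≤-Reasoning
    regroup : ∀ c t m p → (c + t * m) * p ≡ m * (t * p) + c * p
    regroup = solve-∀
    Sparse : ℕ → ℕ → Set
    Sparse t z = ∃ λ (H : Hypergraph (2 + p′) z) → Saturated (2 + m) H × numEdges H ≤ extra + t * m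
    relax : ∀ t → t * p ≤ n → Sparse t n →
      ∃ λ (H : Hypergraph (2 + p′) n) → Saturated (2 + m) H × numEdges H * p ≤ m * n + extra * p
    relax t t*p≤n (H , sat , small) = H , sat , (begin
      numEdges H * p ≤⟨ ℕₚ.*-monoˡ-≤ p small ⟩
      (extra + t * m) * p ≡⟨ regroup extra t m p ⟩
      m * (t * p) + extra * p ≤⟨ ℕₚ.+-monoˡ-≤ (extra * p) (ℕₚ.*-monoʳ-≤ m t*p≤n) ⟩
      m * n + extra * p ∎)
    build : (∃ λ r → ∃ λ t → r ≤ p′ × t * p ≤ n × n ≡ m + (firstSize + ((p + suc r) + t * p))) →
      ∃ λ (H : Hypergraph (2 + p′) n) → Saturated (2 + m) H × numEdges H * p ≤ m * n + extra * p
    build (r , t , r≤p′ , t*p≤n , n≡) = relax t t*p≤n (subst (Sparse t)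
      (trans (cong (λ z → m + (firstSize + (z + t * p))) (secondSize r t r≤p′)) (sym n≡)) (sparseSaturatedAt r t r≤p′))

  -- The value 4(m + 1)²q is what `fewHigh` needs.
  degreeBound : ℕ
  degreeBound = 2 * (suc m * (2 * (suc m * q)))

  neighbourhoodBound : ℕ
  neighbourhoodBound = ((2 + p′) + degreeBound) * (1 + degreeBound * (2 + p′))

  -- h(D + 1) ≤ sk ≤ 2sp ≤ 2(m + 1)n with D = 4(m + 1)²q; then 2(m + 1) is cancelled. The second
  -- inequality is k ≤ 2(k - 1).
  fewHigh : ∀ {n s h} → s * p ≤ suc m * n → h * suc degreeBound ≤ s * (2 + p′) → 2 * (q * (m * h)) ≤ n
  fewHigh {n} {s} {h} sp≤ hD≤ = ℕₚ.*-cancelˡ-≤ (2 * suc m) (begin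
      2 * suc m * (2 * (q * (m * h)))
        ≤⟨ ℕₚ.*-monoʳ-≤ (2 * suc m) (ℕₚ.*-monoʳ-≤ 2 (ℕₚ.*-monoʳ-≤ q (ℕₚ.*-monoˡ-≤ h (ℕₚ.n≤1+n m)))) ⟩
      2 * suc m * (2 * (q * (suc m * h))) ≡⟨ regroup q (suc m) h ⟩
      h * degreeBound ≤⟨ ℕₚ.*-monoʳ-≤ h (ℕₚ.n≤1+n degreeBound) ⟩
      h * suc degreeBound ≤⟨ hD≤ ⟩
      s * (2 + p′) ≤⟨ ℕₚ.*-monoʳ-≤ s (s≤s (ℕₚ.m≤n+m p p′)) ⟩
      s * (p + p) ≡⟨ double s p ⟩
      2 * (s * p) ≤⟨ ℕₚ.*-monoʳ-≤ 2 sp≤ ⟩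
      2 * (suc m * n) ≡⟨ sym (ℕₚ.*-assoc 2 (suc m) n) ⟩
      2 * suc m * n ∎)
    where
    open ℕₚ.≤-Reasoning
    regroup : ∀ q m h → 2 * m * (2 * (q * (m * h))) ≡ h * (2 * (m * (2 * (m * q))))
    regroup = solve-∀
    double : ∀ s p → s * (p + p) ≡ 2 * (s * p)
    double = solve-∀

  -- Each of the two error terms, multiplied by q, is at most n/2.
  absorb : ∀ {n s h} → n * m ≤ (s * p + m * neighbourhoodBound) + m * h →
    2 * (q * (m * neighbourhoodBound)) ≤ n → 2 * (q * (m * h)) ≤ n →
    q * (m * n) ≤ q * (s * p) + n
  absorb {n} {s} {h} main b≤ h≤ = begin
      q * (m * n) ≡⟨ cong (q *_) (ℕₚ.*-comm m n) ⟩
      q * (n * m) ≤⟨ ℕₚ.*-monoʳ-≤ q main ⟩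
      q * ((s * p + m * neighbourhoodBound) + m * h) ≡⟨ distribute q (s * p) (m * neighbourhoodBound) (m * h) ⟩
      q * (s * p) + (q * (m * neighbourhoodBound) + q * (m * h)) ≤⟨ ℕₚ.+-monoʳ-≤ (q * (s * p)) (ℕₚ.*-cancelˡ-≤ 2 halves) ⟩
      q * (s * p) + n ∎
    where
    open ℕₚ.≤-Reasoning
    distribute : ∀ q a b c → q * ((a + b) + c) ≡ q * a + (q * b + q * c)
    distribute = solve-∀
    twice : ∀ n → n + n ≡ 2 * n
    twice = solve-∀
    halves : 2 * (q * (m * neighbourhoodBound) + q * (m * h)) ≤ 2 * n
    halves = begin
      2 * (q * (m * neighbourhoodBound) + q * (m * h)) ≡⟨ ℕₚ.*-distribˡ-+ 2 (q * (m * neighbourhoodBound)) (q * (m * h)) ⟩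
      2 * (q * (m * neighbourhoodBound)) + 2 * (q * (m * h)) ≤⟨ ℕₚ.+-mono-≤ b≤ h≤ ⟩
      n + n ≡⟨ twice n ⟩
      2 * n ∎

  -- A sum, so that n exceeds each summand: room for the construction, the error of the upper bound,
  -- the crude bound sp ≤ (m + 1)n, and the contribution of `T` to the lower bound.
  threshold : ℕ
  threshold = ((offset + q * (extra * p)) + extra * p) + 2 * (q * (m * neighbourhoodBound))

  -- The distance of s(k - 1) from (ℓ - 2)n is at most n/q, cleared of division.
  Asymptotic : ℕ → ℕ → Set
  Asymptotic n s = (q * (s * p) ≤ q * (m * n) + n) × (q * (m * n) ≤ q * (s * p) + n)

  -- The upper bound also feeds the lower one: it yields sp ≤ (m + 1)n, which makes vertices of
  -- degree above `degreeBound` rare.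
  estimate : ∀ {n s} → threshold ≤ n → s * p ≤ m * n + extra * p →
    (H : Hypergraph (2 + p′) n) → Saturated (2 + m) H → numEdges H ≡ s → Asymptotic n s
  estimate {n} le s*p≤ H sat refl = upper , lower (LowerBound.lowerBound p′ m H sat degreeBound)
    where
    open ℕₚ.≤-Reasoning
    le₁ = +-≤-split ((offset + q * (extra * p)) + extra * p) _ le
    le₂ = +-≤-split (offset + q * (extra * p)) _ (proj₁ le₁)
    le₃ = +-≤-split offset _ (proj₁ le₂)
    s : ℕ
    s = numEdges H
    upper : q * (s * p) ≤ q * (m * n) + n
    upper = begin
      q * (s * p) ≤⟨ ℕₚ.*-monoʳ-≤ q s*p≤ ⟩
      q * (m * n + extra * p) ≡⟨ ℕₚ.*-distribˡ-+ q (m * n) (extra * p) ⟩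
      q * (m * n) + q * (extra * p) ≤⟨ ℕₚ.+-monoʳ-≤ (q * (m * n)) (proj₂ le₃) ⟩
      q * (m * n) + n ∎
    s*p≤[1+m]n : s * p ≤ suc m * n
    s*p≤[1+m]n = ℕₚ.≤-trans s*p≤ (ℕₚ.≤-trans (ℕₚ.+-monoʳ-≤ (m * n) (proj₂ le₂)) (ℕₚ.≤-reflexive (ℕₚ.+-comm (m * n) n)))
    lower : (∃ λ h → h * suc degreeBound ≤ s * (2 + p′) × n * m ≤ (s * p + m * neighbourhoodBound) + m * h) →
      q * (m * n) ≤ q * (s * p) + n
    lower (h , high , main) = absorb {n} {s} {h} main (proj₂ le₁) (fewHigh {n} {s} {h} s*p≤[1+m]n high)

  asymptotics : ∀ n → threshold ≤ n → ∃ λ s → IsSatNumber (2 + p′) (2 + m) n s × Asymptotic n s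
  asymptotics n le = attach (sparseSaturated (ℕₚ.≤-trans offset≤threshold le))
    where
    offset≤threshold : offset ≤ threshold
    offset≤threshold = ℕₚ.≤-trans (ℕₚ.m≤m+n offset _) (ℕₚ.≤-trans (ℕₚ.m≤m+n _ (extra * p)) (ℕₚ.m≤m+n _ _))
    attach : (∃ λ (H : Hypergraph (2 + p′) n) → Saturated (2 + m) H × numEdges H * p ≤ m * n + extra * p) →
      ∃ λ s → IsSatNumber (2 + p′) (2 + m) n s × Asymptotic n s
    attach (H , sat , small) = conclude (satNumber (2 + p′) m n H sat)
      where
      conclude : (∃ λ s → IsSatNumber (2 + p′) (2 + m) n s × s ≤ numEdges H) →
        ∃ λ s → IsSatNumber (2 + p′) (2 + m) n s × Asymptotic n s
      conclude (s , number , s≤) = s , number , estimate le (ℕₚ.≤-trans (ℕₚ.*-monoˡ-≤ p s≤) small)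
        (proj₁ (proj₁ number)) (proj₁ (proj₂ (proj₁ number))) (proj₂ (proj₂ (proj₁ number)))

theorem1p2 : (k ℓ : ℕ) → 3 ≤ k → 3 ≤ ℓ →
    (q : ℕ) → 1 ≤ q →
    Σ ℕ λ N → (n : ℕ) → N ≤ n →
    Σ ℕ λ m → IsSatNumber k ℓ n m ×
    (q * (m * (k ∸ 1)) ≤ q * ((ℓ ∸ 2) * n) + n) ×
    (q * ((ℓ ∸ 2) * n) ≤ q * (m * (k ∸ 1)) + n)
theorem1p2 (suc (suc (suc p″))) (suc (suc m)) (s≤s (s≤s (s≤s _))) (s≤s (s≤s _)) q _ = threshold , asymptotics
  where open Asymptotics p″ m q
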